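{- Let $\alpha,\alpha_1,\dots,\alpha_r$ be positive integers with $\alpha<\alpha_1\le\cdots\le\alpha_r$, and let $\boldsymbol{\beta}=(\alpha_1,\dots,\alpha_r)$. Consider the condition (*) for any choice of $\epsilon_1,\dots,\epsilon_r\in\{ -1,0,1\}$, $\sum_{i=1}^r\epsilon_i\alpha_i=0$ implies $\epsilon_i=0$ for every $i$. If (*) holds, then $$\sum_{n\in\mathcal{P}^{\sigma}_{\boldsymbol{\beta}}}n^{ -\frac1\alpha}=\prod_{i=1}^rP\left(\frac{\alpha_i}{\alpha}\right).$$ Moreover, condition (*) is equivalent to the condition that every $n\in\mathcal{P}^{\sigma}_{\boldsymbol{\beta}}$ has a unique representation as $n=p_1^{\alpha_1}\cdots p_r^{\alpha_r}$, i.e. there is exactly one tuple of primes $(p_1,\dots,p_r)$ with $n=p_1^{\alpha_1}\cdots p_r^{\alpha_r}$.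
   Context: For $\boldsymbol{\beta}=(\alpha_1,\dots,\alpha_r)$ a vector of positive integers, $\mathcal{P}^{\sigma}_{\boldsymbol{\beta}}$ is the set of integers $n$ that can be written as $n=p_1^{\alpha_1}\cdots p_r^{\alpha_r}$ with $p_1,\dots,p_r$ primes, not necessarily distinct (a set, so each integer occurs once). $P(s)=\sum_p p^{ -s}$, the sum running over all primes $p$, is the prime zeta function (convergent for real $s>1$). -}

module Defs where

open import Data.Integer.Base as ℤ using (ℤ; +_; 0ℤ; 1ℤ; -1ℤ)
import Data.Integer.Properties as ℤ
open import Data.List.Base as List using (List; []; _∷_; _++_; deduplicate)
open import Data.List.Membership.Propositional using (_∈_)
open import Data.List.Membership.Propositional.Properties
  using (∈-deduplicate⁺; ∈-deduplicate⁻; ∈-++⁺ˡ; ∈-++⁺ʳ; ∈-++⁻)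
open import Data.List.Relation.Binary.Subset.Propositional using (_⊆_)
import Data.List.Relation.Unary.All as ListAll
open import Data.List.Relation.Unary.Unique.Propositional using (Unique)
open import Data.List.Relation.Unary.Unique.DecPropositional.Properties using (deduplicate-!)
open import Data.Nat.Base as ℕ using (ℕ; zero; suc; NonZero; z≤n; s≤s)
open import Data.Nat.Primality using (Prime)
import Data.Nat.Properties as ℕ
import Data.Nat.Solver as ℕ-Solver
open import Data.Product using (∃-syntax; ∃!; _×_; _,_)
open import Data.Rational.Base as ℚ
  using (ℚ; mkℚ; 0ℚ; 1ℚ; ½; _+_; _*_; _-_; -_; _/_; 1/_; ∣_∣; _≤_; *≤*; Positive)
open import Data.Rational.Properties as ℚ using (toℚᵘ-fromℚᵘ; toℚᵘ-homo-+; toℚᵘ-homo-*; toℚᵘ-injective; toℚᵘ-cancel-≤)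
open import Data.Rational.Solver using (module +-*-Solver)
open import Data.Rational.Unnormalised.Base as ℚᵘ using (mkℚᵘ)
import Data.Rational.Unnormalised.Properties as ℚᵘ
open import Data.Sum.Base using (inj₁; inj₂; [_,_]′)
open import Data.Vec.Base using (Vec; zipWith; foldr′)
open import Data.Vec.Relation.Unary.All using (All)
open import Relation.Binary.PropositionalEquality
open import Relation.Nullary using (yes; no; contradiction)
open import Relation.Unary using (Decidable)

split : ∀ ε → ½ * ε + ½ * ε ≡ ε
split = solve 1 (λ e → con ½ :* e :+ con ½ :* e := e) refl
  where open +-*-Solver

half-pos : ∀ ε .{{_ : Positive ε}} → Positive (½ * ε)
half-pos ε = ℚ.pos*pos⇒pos ½ ε

∣-∣-swap : ∀ p q → ∣ p - q ∣ ≡ ∣ q - p ∣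
∣-∣-swap p q = trans (sym (ℚ.∣-p∣≡∣p∣ (p - q))) (cong ∣_∣
  (solve 2 (λ p q → :- (p :- q) := q :- p) refl p q))
  where open +-*-Solver

triangle : ∀ p q r → ∣ p - r ∣ ≤ ∣ p - q ∣ + ∣ q - r ∣
triangle p q r = subst (λ t → ∣ t ∣ ≤ ∣ p - q ∣ + ∣ q - r ∣)
  (solve 3 (λ p q r → (p :- q) :+ (q :- r) := p :- r) refl p q r)
  (ℚ.∣p+q∣≤∣p∣+∣q∣ (p - q) (q - r))
  where open +-*-Solver

+-close : ∀ p p′ q q′ → ∣ (p + q) - (p′ + q′) ∣ ≤ ∣ p - p′ ∣ + ∣ q - q′ ∣
+-close p p′ q q′ = subst (λ t → ∣ t ∣ ≤ ∣ p - p′ ∣ + ∣ q - q′ ∣)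
  (solve 4 (λ p p′ q q′ → (p :- p′) :+ (q :- q′) := (p :+ q) :- (p′ :+ q′)) refl p p′ q q′)
  (ℚ.∣p+q∣≤∣p∣+∣q∣ (p - p′) (q - q′))
  where open +-*-Solver

*-close : ∀ p p′ q q′ → ∣ p * q - p′ * q′ ∣ ≤ ∣ p ∣ * ∣ q - q′ ∣ + ∣ q′ ∣ * ∣ p - p′ ∣
*-close p p′ q q′ = subst₂ _≤_
  (cong ∣_∣ (solve 4 (λ p p′ q q′ → p :* (q :- q′) :+ q′ :* (p :- p′) := p :* q :- p′ :* q′)
    refl p p′ q q′))
  (cong₂ _+_ (ℚ.∣p*q∣≡∣p∣*∣q∣ p (q - q′)) (ℚ.∣p*q∣≡∣p∣*∣q∣ q′ (p - p′)))
  (ℚ.∣p+q∣≤∣p∣+∣q∣ (p * (q - q′)) (q′ * (p - p′)))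
  where open +-*-Solver

*-mono-∣∣ : ∀ p q {B δ} → ∣ p ∣ ≤ B → ∣ q ∣ ≤ δ → ∣ p ∣ * ∣ q ∣ ≤ B * δ
*-mono-∣∣ p q {B} {δ} p≤B q≤δ = ℚ.≤-trans
  (ℚ.*-monoʳ-≤-nonNeg ∣ q ∣ {{ℚ.∣-∣-nonNeg q}} p≤B)
  (ℚ.*-monoˡ-≤-nonNeg B {{ℚ.nonNegative (ℚ.≤-trans (ℚ.0≤∣p∣ p) p≤B)}} q≤δ)

∣-∣≤ : ∀ {p q δ} → p ≤ q + δ → q ≤ p + δ → ∣ p - q ∣ ≤ δ
∣-∣≤ {p} {q} {δ} p≤ q≤ with ℚ.∣p∣≡p∨∣p∣≡-p (p - q)
... | inj₁ eq = subst₂ _≤_ (sym eq)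
      (solve 2 (λ q d → (q :+ d) :- q := d) refl q δ) (ℚ.+-monoˡ-≤ (- q) p≤)
  where open +-*-Solver
... | inj₂ eq = subst₂ _≤_
      (trans (solve 2 (λ p q → q :- p := :- (p :- q)) refl p q) (sym eq))
      (solve 2 (λ p d → (p :+ d) :- p := d) refl p δ) (ℚ.+-monoˡ-≤ (- p) q≤)
  where open +-*-Solver

/-mono-≤ : ∀ a b c d .{{_ : NonZero b}} .{{_ : NonZero d}} →
           a ℕ.* d ℕ.≤ c ℕ.* b → + a / b ≤ + c / d
/-mono-≤ a b@(suc b-1) c d@(suc d-1) ad≤cb = toℚᵘ-cancel-≤ (begin
  ℚ.toℚᵘ (+ a / b)  ≃⟨ toℚᵘ-fromℚᵘ (mkℚᵘ (+ a) b-1) ⟩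
  mkℚᵘ (+ a) b-1    ≤⟨ ℚᵘ.*≤* (subst₂ ℤ._≤_ (ℤ.pos-* a d) (ℤ.pos-* c b) (ℤ.+≤+ ad≤cb)) ⟩
  mkℚᵘ (+ c) d-1    ≃⟨ toℚᵘ-fromℚᵘ (mkℚᵘ (+ c) d-1) ⟨
  ℚ.toℚᵘ (+ c / d)  ∎)
  where open ℚᵘ.≤-Reasoning

/-distrib-+ : ∀ a c d .{{_ : NonZero d}} → + (a ℕ.+ c) / d ≡ + a / d + + c / d
/-distrib-+ a c d@(suc d-1) = toℚᵘ-injective (begin-equality
  ℚ.toℚᵘ (+ (a ℕ.+ c) / d)                ≃⟨ toℚᵘ-fromℚᵘ (mkℚᵘ (+ (a ℕ.+ c)) d-1) ⟩
  mkℚᵘ (+ (a ℕ.+ c)) d-1                  ≃⟨ ℚᵘ.*≡* lemma ⟩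
  mkℚᵘ (+ a) d-1 ℚᵘ.+ mkℚᵘ (+ c) d-1      ≃⟨ ℚᵘ.+-cong (toℚᵘ-fromℚᵘ (mkℚᵘ (+ a) d-1)) (toℚᵘ-fromℚᵘ (mkℚᵘ (+ c) d-1)) ⟨
  ℚ.toℚᵘ (+ a / d) ℚᵘ.+ ℚ.toℚᵘ (+ c / d)  ≃⟨ toℚᵘ-homo-+ (+ a / d) (+ c / d) ⟨
  ℚ.toℚᵘ (+ a / d + + c / d)              ∎)
  where
  open ℚᵘ.≤-Reasoning
  lemma : + (a ℕ.+ c) ℤ.* + (d ℕ.* d) ≡ (+ a ℤ.* + d ℤ.+ + c ℤ.* + d) ℤ.* + d
  lemma = trans (cong (+ (a ℕ.+ c) ℤ.*_) (ℤ.pos-* d d))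
    (trans (sym (ℤ.*-assoc (+ (a ℕ.+ c)) (+ d) (+ d)))
           (cong (ℤ._* + d) (ℤ.*-distribʳ-+ (+ d) (+ a) (+ c))))

/-*-/ : ∀ a b c d .{{_ : NonZero b}} .{{_ : NonZero d}} .{{_ : NonZero (b ℕ.* d)}} →
        (+ a / b) * (+ c / d) ≡ + (a ℕ.* c) / (b ℕ.* d)
/-*-/ a b@(suc b-1) c d@(suc d-1) = toℚᵘ-injective (begin-equality
  ℚ.toℚᵘ ((+ a / b) * (+ c / d))            ≃⟨ toℚᵘ-homo-* (+ a / b) (+ c / d) ⟩
  ℚ.toℚᵘ (+ a / b) ℚᵘ.* ℚ.toℚᵘ (+ c / d)  ≃⟨ ℚᵘ.*-cong (toℚᵘ-fromℚᵘ (mkℚᵘ (+ a) b-1)) (toℚᵘ-fromℚᵘ (mkℚᵘ (+ c) d-1)) ⟩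
  mkℚᵘ (+ a) b-1 ℚᵘ.* mkℚᵘ (+ c) d-1      ≡⟨ cong (λ i → mkℚᵘ i _) (ℤ.pos-* a c) ⟨
  mkℚᵘ (+ (a ℕ.* c)) _                    ≃⟨ toℚᵘ-fromℚᵘ (mkℚᵘ (+ (a ℕ.* c)) _) ⟨
  ℚ.toℚᵘ (+ (a ℕ.* c) / (b ℕ.* d))        ∎)
  where open ℚᵘ.≤-Reasoning

1/denominator≤ : ∀ ε .{{_ : Positive ε}} → + 1 / ℚ.↧ₙ ε ≤ ε
1/denominator≤ ε@(mkℚ (+ suc n) d-1 _) = subst (+ 1 / suc d-1 ≤_) (ℚ.↥p/↧p≡p ε)
  (/-mono-≤ 1 (suc d-1) (suc n) (suc d-1) (ℕ.*-monoˡ-≤ (suc d-1) {1} {suc n} (s≤s z≤n)))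

-- Real numbers as Cauchy sequences of rationals.

IsCauchy : (ℕ → ℚ) → Set
IsCauchy x = ∀ ε .{{_ : Positive ε}} →
  ∃[ N ] ∀ m n → N ℕ.≤ m → N ℕ.≤ n → ∣ x m - x n ∣ ≤ ε

record ℝ : Set where
  field
    approx : ℕ → ℚ
    cauchy : IsCauchy approx

open ℝ public

infix 4 _≈[_]_ _≈_

-- This implies |x - y| ≤ ε and is implied by |x - y| < ε.
_≈[_]_ : ℝ → ℚ → ℝ → Set
x ≈[ ε ] y = ∃[ N ] ∀ n → N ℕ.≤ n → ∣ approx x n - approx y n ∣ ≤ ε

_≈_ : ℝ → ℝ → Set
x ≈ y = ∀ ε .{{_ : Positive ε}} → x ≈[ ε ] y

fromℚ : ℚ → ℝ
fromℚ q .approx _ = q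
fromℚ q .cauchy ε = 0 , λ _ _ _ _ →
  subst (λ t → ∣ t ∣ ≤ ε) (sym (ℚ.+-inverseʳ q)) (ℚ.<⇒≤ (ℚ.positive⁻¹ ε))

0ℝ 1ℝ : ℝ
0ℝ = fromℚ 0ℚ
1ℝ = fromℚ 1ℚ

infixl 6 _+ℝ_
infixl 7 _*ℝ_

_+ℝ_ : ℝ → ℝ → ℝ
(x +ℝ y) .approx n = approx x n + approx y n
(x +ℝ y) .cauchy ε =
  let instance _ = half-pos ε
      M , x≤ = cauchy x (½ * ε)
      N , y≤ = cauchy y (½ * ε)
  in M ℕ.⊔ N , λ m n m≥ n≥ → ℚ.≤-trans
       (+-close (approx x m) (approx x n) (approx y m) (approx y n))
       (subst (_ ≤_) (split ε) (ℚ.+-mono-≤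
         (x≤ m n (ℕ.m⊔n≤o⇒m≤o M N m≥) (ℕ.m⊔n≤o⇒m≤o M N n≥))
         (y≤ m n (ℕ.m⊔n≤o⇒n≤o M N m≥) (ℕ.m⊔n≤o⇒n≤o M N n≥))))

bounded : ∀ x → ∃[ B ] ∃[ N ] 0ℚ ≤ B × ∀ n → N ℕ.≤ n → ∣ approx x n ∣ ≤ B
bounded x =
  let N , x≤ = cauchy x 1ℚ
      a = approx x N
  in ∣ a ∣ + 1ℚ , N ,
     ℚ.+-mono-≤ (ℚ.0≤∣p∣ a) (ℚ.nonNegative⁻¹ 1ℚ) ,
     λ n n≥ → subst (λ t → ∣ t ∣ ≤ ∣ a ∣ + 1ℚ)
       (solve 2 (λ a b → a :+ (b :- a) := b) refl a (approx x n))
       (ℚ.≤-trans (ℚ.∣p+q∣≤∣p∣+∣q∣ a (approx x n - a))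
                  (ℚ.+-monoʳ-≤ ∣ a ∣ (x≤ n N n≥ ℕ.≤-refl)))
  where open +-*-Solver

*-cauchy : ∀ x y → IsCauchy (λ n → approx x n * approx y n)
*-cauchy x y ε =
  let A , K , 0≤A , x≤A = bounded x
      B , L , 0≤B , y≤B = bounded y
      C = A + B + 1ℚ
      instance
        A≥0 = ℚ.nonNegative 0≤A
        B≥0 = ℚ.nonNegative 0≤B
        A+B≥0 = ℚ.nonNeg+nonNeg⇒nonNeg A B
        C>0 = ℚ.nonNeg+pos⇒pos (A + B) 1ℚ
        C≢0 = ℚ.pos⇒nonZero C
        1/C>0 = ℚ.1/pos⇒pos C
        δ>0 = ℚ.pos*pos⇒pos (1/ C) ε
      δ = 1/ C * ε
      M , x≤δ = cauchy x δ
      N , y≤δ = cauchy y δ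
      bound : A * δ + B * δ ≤ ε
      bound = begin
        A * δ + B * δ   ≡⟨ ℚ.*-distribʳ-+ δ A B ⟨
        (A + B) * δ     ≤⟨ ℚ.*-monoʳ-≤-nonNeg δ {{ℚ.pos⇒nonNeg δ}}
                             (subst (_≤ C) (ℚ.+-identityʳ (A + B))
                               (ℚ.+-monoʳ-≤ (A + B) (ℚ.nonNegative⁻¹ 1ℚ))) ⟩
        C * (1/ C * ε)  ≡⟨ ℚ.*-assoc C (1/ C) ε ⟨
        C * 1/ C * ε    ≡⟨ cong (_* ε) (ℚ.*-inverseʳ C) ⟩
        1ℚ * ε          ≡⟨ ℚ.*-identityˡ ε ⟩
        ε               ∎
  in (K ℕ.⊔ L) ℕ.⊔ (M ℕ.⊔ N) , λ m n m≥ n≥ →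
     let m≥KL = ℕ.m⊔n≤o⇒m≤o (K ℕ.⊔ L) (M ℕ.⊔ N) m≥
         n≥KL = ℕ.m⊔n≤o⇒m≤o (K ℕ.⊔ L) (M ℕ.⊔ N) n≥
         m≥MN = ℕ.m⊔n≤o⇒n≤o (K ℕ.⊔ L) (M ℕ.⊔ N) m≥
         n≥MN = ℕ.m⊔n≤o⇒n≤o (K ℕ.⊔ L) (M ℕ.⊔ N) n≥
     in ℚ.≤-trans (*-close (approx x m) (approx x n) (approx y m) (approx y n))
       (ℚ.≤-trans (ℚ.+-mono-≤
         (*-mono-∣∣ (approx x m) (approx y m - approx y n)
           (x≤A m (ℕ.m⊔n≤o⇒m≤o K L m≥KL))
           (y≤δ m n (ℕ.m⊔n≤o⇒n≤o M N m≥MN) (ℕ.m⊔n≤o⇒n≤o M N n≥MN)))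
         (*-mono-∣∣ (approx y n) (approx x m - approx x n)
           (y≤B n (ℕ.m⊔n≤o⇒n≤o K L n≥KL))
           (x≤δ m n (ℕ.m⊔n≤o⇒m≤o M N m≥MN) (ℕ.m⊔n≤o⇒m≤o M N n≥MN))))
         bound)
  where open ℚ.≤-Reasoning

_*ℝ_ : ℝ → ℝ → ℝ
(x *ℝ y) .approx n = approx x n * approx y n
(x *ℝ y) .cauchy   = *-cauchy x y

infixr 8 _^ℝ_
_^ℝ_ : ℝ → ℕ → ℝ
x ^ℝ zero  = 1ℝ
x ^ℝ suc b = x *ℝ x ^ℝ b

∏ : ∀ {r} → Vec ℝ r → ℝ
∏ = foldr′ _*ℝ_ 1ℝ

-- The largest m ≤ N satisfying P, or 0 if there is none.
largest : {P : ℕ → Set} → Decidable P → ℕ → ℕ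
largest P? zero = zero
largest P? (suc N) with P? (suc N)
... | yes _ = suc N
... | no  _ = largest P? N

largest-≤ : ∀ {P : ℕ → Set} (P? : Decidable P) N → largest P? N ℕ.≤ N
largest-≤ P? zero = z≤n
largest-≤ P? (suc N) with P? (suc N)
... | yes _ = ℕ.≤-refl
... | no  _ = ℕ.m≤n⇒m≤1+n (largest-≤ P? N)

largest-holds : ∀ {P : ℕ → Set} (P? : Decidable P) N → P 0 → P (largest P? N)
largest-holds P? zero P0 = P0
largest-holds P? (suc N) P0 with P? (suc N)
... | yes P1+N = P1+N
... | no  _    = largest-holds P? N P0

largest-maximal : ∀ {P : ℕ → Set} (P? : Decidable P) N {m} → m ℕ.≤ N → P m → m ℕ.≤ largest P? N
largest-maximal P? zero z≤n _ = z≤n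
largest-maximal P? (suc N) m≤ Pm with P? (suc N)
... | yes _ = m≤
... | no ¬P with ℕ.m≤n⇒m<n∨m≡n m≤
...   | inj₁ (s≤s m≤N) = largest-maximal P? N m≤N Pm
...   | inj₂ refl      = contradiction Pm ¬P

-- ⌊ K · n^(-a/b) ⌋ for n ≥ 1: since n^(-a/b) ≤ 1, it is the largest m ≤ K with
-- m^b · n^a ≤ K^b.
⌊_*_^-[_/_]⌋ : ℕ → ℕ → ℕ → ℕ → ℕ
⌊ K * n ^-[ a / b ]⌋ = largest (λ m → m ℕ.^ b ℕ.* n ℕ.^ a ℕ.≤? K ℕ.^ b) K

^-distribʳ-* : ∀ x y b → (x ℕ.* y) ℕ.^ b ≡ x ℕ.^ b ℕ.* y ℕ.^ b
^-distribʳ-* x y zero    = refl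
^-distribʳ-* x y (suc b) = trans (cong (x ℕ.* y ℕ.*_) (^-distribʳ-* x y b))
  (ℕ.[m*n]*[o*p]≡[m*o]*[n*p] x y (x ℕ.^ b) (y ℕ.^ b))

floor-cross : ∀ n a b .{{_ : NonZero b}} K L →
  ⌊ K * n ^-[ a / b ]⌋ ℕ.* L ℕ.≤ suc ⌊ L * n ^-[ a / b ]⌋ ℕ.* K
floor-cross n a b@(suc _) K L = go (ℕ.m≤n⇒m<n∨m≡n (largest-≤ Q? L))
  where
  P? = λ m → m ℕ.^ b ℕ.* n ℕ.^ a ℕ.≤? K ℕ.^ b
  Q? = λ m → m ℕ.^ b ℕ.* n ℕ.^ a ℕ.≤? L ℕ.^ b
  k = ⌊ K * n ^-[ a / b ]⌋
  l = ⌊ L * n ^-[ a / b ]⌋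

  swap : ∀ x y z → x ℕ.* y ℕ.* z ≡ x ℕ.* z ℕ.* y
  swap x y z = trans (ℕ.*-assoc x y z)
    (trans (cong (x ℕ.*_) (ℕ.*-comm y z)) (sym (ℕ.*-assoc x z y)))

  go : _ → _
  go (inj₂ l≡L) = ℕ.≤-trans
    (ℕ.*-mono-≤ (largest-≤ P? K) (ℕ.≤-trans (ℕ.≤-reflexive (sym l≡L)) (ℕ.n≤1+n l)))
    (ℕ.≤-reflexive (ℕ.*-comm K (suc l)))
  go (inj₁ l<L) with k ℕ.* L ℕ.≤? suc l ℕ.* K
  ... | yes ≤ = ≤
  ... | no  ≰ = contradiction (largest-maximal Q? L l<L fits) (ℕ.<⇒≱ ℕ.≤-refl)
    where
    open ℕ.≤-Reasoning
    instance
      K≢0 : NonZero K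
      K≢0 = ℕ.≢-nonZero λ K≡0 → ≰ (ℕ.≤-trans (ℕ.*-monoˡ-≤ L (largest-≤ P? K))
        (ℕ.≤-reflexive (trans (cong (ℕ._* L) K≡0) (trans (sym (ℕ.*-zeroʳ (suc l))) (cong (suc l ℕ.*_) (sym K≡0))))))
      K^b≢0 : NonZero (K ℕ.^ b)
      K^b≢0 = ℕ.m^n≢0 K b
    fits : suc l ℕ.^ b ℕ.* n ℕ.^ a ℕ.≤ L ℕ.^ b
    fits = ℕ.*-cancelʳ-≤ _ _ (K ℕ.^ b) (begin
      suc l ℕ.^ b ℕ.* n ℕ.^ a ℕ.* K ℕ.^ b  ≡⟨ swap (suc l ℕ.^ b) (n ℕ.^ a) (K ℕ.^ b) ⟩
      suc l ℕ.^ b ℕ.* K ℕ.^ b ℕ.* n ℕ.^ a  ≡⟨ cong (ℕ._* n ℕ.^ a) (^-distribʳ-* (suc l) K b) ⟨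
      (suc l ℕ.* K) ℕ.^ b ℕ.* n ℕ.^ a      ≤⟨ ℕ.*-monoˡ-≤ (n ℕ.^ a) (ℕ.^-monoˡ-≤ b (ℕ.<⇒≤ (ℕ.≰⇒> ≰))) ⟩
      (k ℕ.* L) ℕ.^ b ℕ.* n ℕ.^ a          ≡⟨ cong (ℕ._* n ℕ.^ a) (^-distribʳ-* k L b) ⟩
      k ℕ.^ b ℕ.* L ℕ.^ b ℕ.* n ℕ.^ a      ≡⟨ swap (k ℕ.^ b) (L ℕ.^ b) (n ℕ.^ a) ⟩
      k ℕ.^ b ℕ.* n ℕ.^ a ℕ.* L ℕ.^ b      ≤⟨ ℕ.*-monoˡ-≤ (L ℕ.^ b) (largest-holds P? K z≤n) ⟩
      K ℕ.^ b ℕ.* L ℕ.^ b                  ≡⟨ ℕ.*-comm (K ℕ.^ b) (L ℕ.^ b) ⟩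
      L ℕ.^ b ℕ.* K ℕ.^ b                  ∎)

-- The real number n^(-a/b), for n ≥ 1, as the limit of ⌊ K · n^(-a/b) ⌋ / K with
-- K = k + 1. At n = 0 the value is junk.
infixr 8 _^-[_/_]
_^-[_/_] : ℕ → ℕ → (b : ℕ) .{{_ : NonZero b}} → ℝ
(n ^-[ a / b ]) .approx k = + ⌊ suc k * n ^-[ a / b ]⌋ / suc k
(n ^-[ a / b ]) .cauchy ε = ℚ.↧ₙ ε , λ k l k≥ l≥ →
  ℚ.≤-trans (∣-∣≤ (step k l l≥) (step l k k≥)) (1/denominator≤ ε)
  where
  open ℚ.≤-Reasoning
  D = ℚ.↧ₙ ε
  f = λ k → ⌊ suc k * n ^-[ a / b ]⌋
  step : ∀ k l → D ℕ.≤ l → + f k / suc k ≤ + f l / suc l + + 1 / D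
  step k l D≤l = begin
    + f k / suc k                ≤⟨ /-mono-≤ (f k) (suc k) (suc (f l)) (suc l) (floor-cross n a b (suc k) (suc l)) ⟩
    + (suc (f l)) / suc l        ≡⟨ cong (λ t → + t / suc l) (ℕ.+-comm 1 (f l)) ⟩
    + (f l ℕ.+ 1) / suc l        ≡⟨ /-distrib-+ (f l) 1 (suc l) ⟩
    + f l / suc l + + 1 / suc l  ≤⟨ ℚ.+-monoʳ-≤ (+ f l / suc l) (/-mono-≤ 1 (suc l) 1 D
                                      (ℕ.*-monoʳ-≤ 1 (ℕ.m≤n⇒m≤1+n D≤l))) ⟩
    + f l / suc l + + 1 / D      ∎

-- n^(-a/b) is a root of x^b · n^a = 1, and its approximations are nonnegative.
^-[/]-spec : ∀ n a b .{{_ : NonZero n}} .{{_ : NonZero b}} →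
             (n ^-[ a / b ]) ^ℝ b *ℝ fromℚ (+ (n ℕ.^ a) / 1) ≈ 1ℝ
^-[/]-spec n a b ε = c ℕ.* b ℕ.* D , λ k k≥ →
  let instance
        K^b≢0 = ℕ.m^n≢0 (suc k) b
        K^b*1≢0 = ℕ.m*n≢0 (suc k ℕ.^ b) 1
  in subst (λ t → ∣ t - 1ℚ ∣ ≤ ε) (sym (value k))
    (ℚ.≤-trans (∣-∣≤ (upper k) (lower k k≥)) (1/denominator≤ ε))
  where
  D = ℚ.↧ₙ ε
  c = n ℕ.^ a
  f = λ k → ⌊ suc k * n ^-[ a / b ]⌋
  P? = λ k m → m ℕ.^ b ℕ.* c ℕ.≤? suc k ℕ.^ b
  c≥1 : 1 ℕ.≤ c
  c≥1 = ℕ.m^n>0 n a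

  0^ : ∀ e .{{_ : NonZero e}} → 0 ℕ.^ e ≡ 0
  0^ (suc _) = refl

  0^b*c≤ : ∀ x → 0 ℕ.^ b ℕ.* c ℕ.≤ x
  0^b*c≤ x = subst (λ t → t ℕ.* c ℕ.≤ x) (sym (0^ b)) z≤n

  power : ∀ k e .{{_ : NonZero (suc k ℕ.^ e)}} →
          approx ((n ^-[ a / b ]) ^ℝ e) k ≡ + (f k ℕ.^ e) / suc k ℕ.^ e
  power k zero    = refl
  power k (suc e) = trans (cong (+ f k / suc k *_) (power k e))
    (/-*-/ (f k) (suc k) (f k ℕ.^ e) (suc k ℕ.^ e))
    where instance _ = ℕ.m^n≢0 (suc k) e

  value : ∀ k .{{_ : NonZero (suc k ℕ.^ b)}} .{{_ : NonZero (suc k ℕ.^ b ℕ.* 1)}} →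
          approx ((n ^-[ a / b ]) ^ℝ b) k * (+ c / 1) ≡
          + (f k ℕ.^ b ℕ.* c) / (suc k ℕ.^ b ℕ.* 1)
  value k = trans (cong (_* (+ c / 1)) (power k b)) (/-*-/ (f k ℕ.^ b) (suc k ℕ.^ b) c 1)

  upper : ∀ k .{{_ : NonZero (suc k ℕ.^ b ℕ.* 1)}} →
          + (f k ℕ.^ b ℕ.* c) / (suc k ℕ.^ b ℕ.* 1) ≤ 1ℚ + + 1 / D
  upper k = ℚ.≤-trans
    (/-mono-≤ (f k ℕ.^ b ℕ.* c) (suc k ℕ.^ b ℕ.* 1) 1 1
      (subst₂ ℕ._≤_ (sym (ℕ.*-identityʳ (f k ℕ.^ b ℕ.* c)))
        (sym (trans (ℕ.*-identityˡ (suc k ℕ.^ b ℕ.* 1)) (ℕ.*-identityʳ (suc k ℕ.^ b))))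
        (largest-holds (P? k) (suc k) (0^b*c≤ (suc k ℕ.^ b)))))
    (ℚ.+-monoʳ-≤ 1ℚ (/-mono-≤ 0 1 1 D z≤n))

  suc^ : ∀ K m e → suc m ℕ.≤ K → suc m ℕ.^ e ℕ.* K ℕ.≤ m ℕ.^ e ℕ.* K ℕ.+ e ℕ.* K ℕ.^ e
  suc^ K m zero    m<K = ℕ.m≤m+n _ _
  suc^ K m (suc e) m<K = begin
    suc m ℕ.* suc m ℕ.^ e ℕ.* K
      ≡⟨ ℕ.*-assoc (suc m) (suc m ℕ.^ e) K ⟩
    suc m ℕ.* (suc m ℕ.^ e ℕ.* K)
      ≤⟨ ℕ.*-monoʳ-≤ (suc m) (suc^ K m e m<K) ⟩
    suc m ℕ.* (m ℕ.^ e ℕ.* K ℕ.+ e ℕ.* K ℕ.^ e)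
      ≡⟨ solve 4 (λ m me K eK → (con 1 :+ m) :* (me :* K :+ eK) :=
                   m :* me :* K :+ (K :* me :+ (con 1 :+ m) :* eK)) refl
               m (m ℕ.^ e) K (e ℕ.* K ℕ.^ e) ⟩
    m ℕ.* m ℕ.^ e ℕ.* K ℕ.+ (K ℕ.* m ℕ.^ e ℕ.+ suc m ℕ.* (e ℕ.* K ℕ.^ e))
      ≤⟨ ℕ.+-monoʳ-≤ (m ℕ.* m ℕ.^ e ℕ.* K) (ℕ.+-mono-≤
           (ℕ.*-monoʳ-≤ K (ℕ.^-monoˡ-≤ e (ℕ.<⇒≤ m<K)))
           (ℕ.*-monoˡ-≤ (e ℕ.* K ℕ.^ e) m<K)) ⟩
    m ℕ.* m ℕ.^ e ℕ.* K ℕ.+ (K ℕ.* K ℕ.^ e ℕ.+ K ℕ.* (e ℕ.* K ℕ.^ e))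
      ≡⟨ cong (m ℕ.* m ℕ.^ e ℕ.* K ℕ.+_)
           (solve 3 (λ K e Ke → K :* Ke :+ K :* (e :* Ke) := (con 1 :+ e) :* (K :* Ke)) refl
             K e (K ℕ.^ e)) ⟩
    m ℕ.* m ℕ.^ e ℕ.* K ℕ.+ suc e ℕ.* (K ℕ.* K ℕ.^ e) ∎
    where
    open ℕ.≤-Reasoning
    open ℕ-Solver.+-*-Solver

  K≤f : ∀ k → suc k ℕ.^ b ℕ.* suc k ℕ.≤
              f k ℕ.^ b ℕ.* c ℕ.* suc k ℕ.+ c ℕ.* b ℕ.* suc k ℕ.^ b
  K≤f k with ℕ.m≤n⇒m<n∨m≡n (largest-≤ (P? k) (suc k))
  ... | inj₂ f≡K = ℕ.≤-trans
        (ℕ.*-monoˡ-≤ (suc k) (subst (λ t → suc k ℕ.^ b ℕ.≤ t ℕ.^ b ℕ.* c) (sym f≡K)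
          (ℕ.≤-trans (ℕ.≤-reflexive (sym (ℕ.*-identityʳ (suc k ℕ.^ b)))) (ℕ.*-monoʳ-≤ (suc k ℕ.^ b) c≥1))))
        (ℕ.m≤m+n _ _)
  ... | inj₁ f<K = begin
    K^b ℕ.* K
      ≤⟨ ℕ.*-monoˡ-≤ K (ℕ.<⇒≤ (ℕ.≰⇒> λ fits →
           ℕ.<⇒≱ ℕ.≤-refl (largest-maximal (P? k) K f<K fits))) ⟩
    suc (f k) ℕ.^ b ℕ.* c ℕ.* K
      ≡⟨ solve 3 (λ x c K → x :* c :* K := c :* (x :* K)) refl (suc (f k) ℕ.^ b) c K ⟩
    c ℕ.* (suc (f k) ℕ.^ b ℕ.* K)
      ≤⟨ ℕ.*-monoʳ-≤ c (suc^ K (f k) b f<K) ⟩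
    c ℕ.* (f k ℕ.^ b ℕ.* K ℕ.+ b ℕ.* K^b)
      ≡⟨ solve 5 (λ c x K b Kb → c :* (x :* K :+ b :* Kb) := x :* c :* K :+ c :* b :* Kb) refl
           c (f k ℕ.^ b) K b K^b ⟩
    f k ℕ.^ b ℕ.* c ℕ.* K ℕ.+ c ℕ.* b ℕ.* K^b ∎
    where
    open ℕ.≤-Reasoning
    open ℕ-Solver.+-*-Solver
    K = suc k
    K^b = suc k ℕ.^ b

  lower : ∀ k .{{_ : NonZero (suc k ℕ.^ b)}} .{{_ : NonZero (suc k ℕ.^ b ℕ.* 1)}} →
          c ℕ.* b ℕ.* D ℕ.≤ k →
          1ℚ ≤ + (f k ℕ.^ b ℕ.* c) / (suc k ℕ.^ b ℕ.* 1) + + 1 / D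
  lower k k≥ = begin
    1ℚ
      ≤⟨ /-mono-≤ 1 1 (x ℕ.* K ℕ.+ y) (K^b ℕ.* K)
           (subst₂ ℕ._≤_ (sym (ℕ.*-identityˡ (K^b ℕ.* K)))
             (sym (ℕ.*-identityʳ (x ℕ.* K ℕ.+ y))) (K≤f k)) ⟩
    + (x ℕ.* K ℕ.+ y) / (K^b ℕ.* K)
      ≡⟨ /-distrib-+ (x ℕ.* K) y (K^b ℕ.* K) ⟩
    + (x ℕ.* K) / (K^b ℕ.* K) + + y / (K^b ℕ.* K)
      ≤⟨ ℚ.+-mono-≤
           (/-mono-≤ (x ℕ.* K) (K^b ℕ.* K) x (K^b ℕ.* 1) (ℕ.≤-reflexive
             (solve 3 (λ x K Kb → x :* K :* (Kb :* con 1) := x :* (Kb :* K)) refl x K K^b)))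
           (/-mono-≤ y (K^b ℕ.* K) 1 D small) ⟩
    + x / (K^b ℕ.* 1) + + 1 / D ∎
    where
    open ℚ.≤-Reasoning
    open ℕ-Solver.+-*-Solver
    K = suc k
    K^b = suc k ℕ.^ b
    x = f k ℕ.^ b ℕ.* c
    y = c ℕ.* b ℕ.* K^b
    instance _ = ℕ.m*n≢0 K^b K
    small : y ℕ.* D ℕ.≤ 1 ℕ.* (K^b ℕ.* K)
    small = subst₂ ℕ._≤_
      (solve 3 (λ Kb cb d → Kb :* (cb :* d) := cb :* Kb :* d) refl K^b (c ℕ.* b) D)
      (sym (ℕ.*-identityˡ (K^b ℕ.* K)))
      (ℕ.*-monoʳ-≤ K^b (ℕ.m≤n⇒m≤1+n k≥))

-- F enumerates a finite subset of S without repetition.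
FiniteSubset : (ℕ → Set) → List ℕ → Set
FiniteSubset S F = Unique F × ListAll.All S F

Σ[_]_ : List ℕ → (ℕ → ℝ) → ℝ
Σ[ F ] f = List.foldr (λ n s → f n +ℝ s) 0ℝ F

-- Unordered summation: the finite partial sums of f over S converge to s along
-- the finite subsets of S directed by inclusion. For the nonnegative terms used
-- here this is the usual sum of the series.
HasSum : (ℕ → Set) → (ℕ → ℝ) → ℝ → Set
HasSum S f s = ∀ ε .{{_ : Positive ε}} →
  ∃[ F₀ ] FiniteSubset S F₀ ×
    (∀ F → FiniteSubset S F → F₀ ⊆ F → Σ[ F ] f ≈[ ε ] s)

HasSum-unique : ∀ {S f s t} → HasSum S f s → HasSum S f t → s ≈ t
HasSum-unique {S} {f} {s} {t} fs ft ε =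
  let instance _ = half-pos ε
      F , (_ , F⊆S) , near-s = fs (½ * ε)
      G , (_ , G⊆S) , near-t = ft (½ * ε)
      H = deduplicate ℕ._≟_ (F ++ G)
      H⊆S : FiniteSubset S H
      H⊆S = deduplicate-! ℕ._≟_ (F ++ G) , ListAll.tabulate λ n∈H →
        [ ListAll.lookup F⊆S , ListAll.lookup G⊆S ]′
          (∈-++⁻ F (∈-deduplicate⁻ ℕ._≟_ (F ++ G) n∈H))
      M , s≤ = near-s H H⊆S (λ n∈F → ∈-deduplicate⁺ ℕ._≟_ (∈-++⁺ˡ n∈F))
      N , t≤ = near-t H H⊆S (λ n∈G → ∈-deduplicate⁺ ℕ._≟_ (∈-++⁺ʳ F n∈G))
      u = approx (Σ[ H ] f)
  in M ℕ.⊔ N , λ n n≥ → ℚ.≤-trans (triangle (approx s n) (u n) (approx t n))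
       (subst (∣ approx s n - u n ∣ + ∣ u n - approx t n ∣ ≤_) (split ε) (ℚ.+-mono-≤
         (subst (_≤ ½ * ε) (∣-∣-swap (u n) (approx s n)) (s≤ n (ℕ.m⊔n≤o⇒m≤o M N n≥)))
         (t≤ n (ℕ.m⊔n≤o⇒n≤o M N n≥))))

-- P(a/b) = x. By HasSum-unique there is at most one such x.
PrimeZeta[_/_]≈_ : ℕ → (b : ℕ) .{{_ : NonZero b}} → ℝ → Set
PrimeZeta[ a / b ]≈ x = HasSum Prime (λ p → p ^-[ a / b ]) x

Represents : ∀ {r} → Vec ℕ r → Vec ℕ r → ℕ → Set
Represents β ps n = All Prime ps × n ≡ foldr′ ℕ._*_ 1 (zipWith ℕ._^_ ps β)

𝒫σ : ∀ {r} → Vec ℕ r → ℕ → Set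
𝒫σ β n = ∃[ ps ] Represents β ps n

UniqueRepresentations : ∀ {r} → Vec ℕ r → Set
UniqueRepresentations β = ∀ n → 𝒫σ β n → ∃! _≡_ (λ ps → Represents β ps n)

SignedSumFree : ∀ {r} → Vec ℕ r → Set
SignedSumFree {r} β = ∀ (ε : Vec ℤ r) → All (_∈ -1ℤ ∷ 0ℤ ∷ 1ℤ ∷ []) ε →
  foldr′ ℤ._+_ 0ℤ (zipWith (λ e a → e ℤ.* + a) ε β) ≡ 0ℤ → All (_≡ 0ℤ) ε

{-# OPTIONS --safe #-}
module Submission where

open import Defs
open import Data.Integer.Base as ℤ using (ℤ; +_; -[1+_]; 0ℤ; 1ℤ; -1ℤ)
import Data.Integer.Properties as ℤ
import Data.Integer.Solver as ℤ-Solver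
open import Data.List.Base using (List; []; _∷_; _++_; map; filter; upTo; length; cartesianProduct; deduplicate)
open import Data.List.Properties using (length-map; length-upTo)
import Data.List.Membership.Propositional as List
open import Data.List.Membership.Propositional.Properties
  using (∈-∃++; ∈-++⁺ˡ; ∈-++⁺ʳ; ∈-++⁻; ∈-filter⁺; ∈-filter⁻; ∈-upTo⁺; ∈-upTo⁻; ∈-map⁺; ∈-map⁻;
         ∈-deduplicate⁺; ∈-deduplicate⁻; ∈-cartesianProduct⁺; ∈-cartesianProduct⁻)
open import Data.List.Relation.Binary.Subset.Propositional using (_⊆_)
import Data.List.Relation.Unary.All as ListAll
import Data.List.Relation.Unary.All.Properties as ListAll
open import Data.List.Relation.Unary.AllPairs using ([]; _∷_)
open import Data.List.Relation.Unary.Any using (here; there)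
open import Data.List.Relation.Unary.Unique.Propositional using (Unique)
import Data.List.Relation.Unary.Unique.Propositional.Properties as Unique
open import Data.List.Relation.Unary.Unique.DecPropositional.Properties using (deduplicate-!)
open import Data.Nat.Base using (ℕ; zero; suc; NonZero; _≤_; _<_)
import Data.Nat.Base as ℕ
import Data.Nat.Divisibility as ℕ
open import Data.Nat.Primality using (Prime; prime?; euclidsLemma; prime⇒irreducible; prime⇒nonZero; ¬prime[1])
import Data.Nat.Properties as ℕ
open import Data.Nat.Solver using (module +-*-Solver)
open import Data.Product using (Σ-syntax; ∃-syntax; _×_; _,_; proj₁; proj₂; uncurry)
open import Data.Rational.Base as ℚ using (ℚ; 0ℚ; 1ℚ; ½; _+_; _*_; _-_; -_; _/_; 1/_; ∣_∣; Positive)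
import Data.Rational.Properties as ℚ
import Data.Rational.Solver as ℚ-Solver
open import Data.Sum.Base using (inj₁; inj₂)
open import Data.Vec.Base as Vec using (Vec; []; _∷_; head; lookup; zipWith; foldr′)
open import Data.Vec.Properties using (∷-injective; lookup-map; lookup-zipWith)
open import Data.Vec.Relation.Binary.Pointwise.Extensional using (ext; Pointwise-≡⇒≡)
open import Data.Vec.Relation.Binary.Pointwise.Inductive as Pointwise using (Pointwise; []; _∷_)
open import Data.Vec.Relation.Unary.All as All using (All; []; _∷_)
import Data.Vec.Relation.Unary.All.Properties as All
open import Data.Vec.Relation.Unary.Linked using (Linked)
open import Data.Vec.Relation.Unary.Linked.Properties using (Linked⇒All)
open import Function.Base using (case_of_)
open import Function.Bundles using (_⇔_; mk⇔)
open import Relation.Binary.PropositionalEquality hiding (J)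
open import Relation.Nullary using (yes; no; contradiction)
open import Relation.Nullary.Decidable using (from-yes)
open import Relation.Unary using (Decidable)

-- If two tuples of primes have the same value, compare p-adic valuations: with εᵢ = [pᵢ = p] - [qᵢ = p]
-- we get Σ εᵢ αᵢ = 0 for every prime p, so (*) forces the tuples to agree. Conversely a nontrivial
-- relation Σ εᵢ αᵢ = 0 gives two representations of one integer: put 2 where εᵢ = 1, 3 where εᵢ = -1,
-- and 2 in both elsewhere, then exchange the roles of 2 and 3 on the support of ε.
--
-- The prime zeta values exist because n^(-a/b) ≤ 2^(-j(b+1)) on [2^(bj), 2^(b(j+1))) when a ≥ b + 1, so
-- the j-th block of the series contributes at most 2^(b-j); since this bound already holds for every
-- rational approximation, tails are small uniformly and the k-th approximation of the sum may be taken
-- to be the k-th approximation of its first k terms. Unique representation makes (p, n) ↦ p^α₁ n a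
-- bijection from primes × 𝒫σ(α₂,…,α_r) onto 𝒫σ(α₁,…,α_r), and the product formula follows by
-- induction on r from the product of two nonnegative unordered sums.

open ℤ-Solver.+-*-Solver using ()
  renaming (solve to solveℤ; con to conℤ; _:*_ to _⊗_; _:+_ to _⊕_; _:-_ to _⊖_; _:=_ to _⊜_)

private variable
  A B : Set

-- Unique representation and condition (*)

value : ∀ {r} → Vec ℕ r → Vec ℕ r → ℕ
value β ps = foldr′ ℕ._*_ 1 (zipWith ℕ._^_ ps β)

χ : ℕ → ℕ → ℕ
χ p x with p ℕ.≟ x
... | yes _ = 1
... | no  _ = 0

-- For prime `p` and prime entries this is the `p`-adic valuation of `value β ps`, read off from the
-- tuple.
multiplicity : ∀ {r} → ℕ → Vec ℕ r → Vec ℕ r → ℕ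
multiplicity p []      []       = 0
multiplicity p (a ∷ β) (x ∷ ps) = χ p x ℕ.* a ℕ.+ multiplicity p β ps

prime∣prime^⇒≡ : ∀ {p q} a → Prime p → Prime q → p ℕ.∣ q ℕ.^ a → p ≡ q
prime∣prime^⇒≡ zero pp qp p∣1 = contradiction (subst Prime (ℕ.∣1⇒≡1 p∣1) pp) ¬prime[1]
prime∣prime^⇒≡ {p} {q} (suc a) pp qp p∣ with euclidsLemma q (q ℕ.^ a) pp p∣
... | inj₂ p∣q^a = prime∣prime^⇒≡ a pp qp p∣q^a
... | inj₁ p∣q with prime⇒irreducible qp p∣q
...   | inj₁ p≡1 = contradiction (subst Prime p≡1 pp) ¬prime[1]
...   | inj₂ p≡q = p≡q

-- The cofactor `c` collects the powers of the entries different from `p`. By Euclid's lemma a prime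
-- dividing `c` would divide one of these entries, hence equal it.
value-multiplicity : ∀ {r p} (β ps : Vec ℕ r) → Prime p → All Prime ps →
  ∃[ c ] value β ps ≡ p ℕ.^ multiplicity p β ps ℕ.* c × p ℕ.∤ c
value-multiplicity [] [] pp [] =
  1 , refl , λ p∣1 → contradiction (subst Prime (ℕ.∣1⇒≡1 p∣1) pp) ¬prime[1]
value-multiplicity {p = p} (a ∷ β) (x ∷ ps) pp (xp ∷ psp)
  with c , eq , p∤c ← value-multiplicity β ps pp psp | p ℕ.≟ x
... | yes refl = c , lemma , p∤c
  where
  open ≡-Reasoning
  m = multiplicity p β ps
  lemma : p ℕ.^ a ℕ.* value β ps ≡ p ℕ.^ (1 ℕ.* a ℕ.+ m) ℕ.* c
  lemma = begin
    p ℕ.^ a ℕ.* value β ps             ≡⟨ cong (p ℕ.^ a ℕ.*_) eq ⟩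
    p ℕ.^ a ℕ.* (p ℕ.^ m ℕ.* c)        ≡⟨ ℕ.*-assoc (p ℕ.^ a) (p ℕ.^ m) c ⟨
    p ℕ.^ a ℕ.* p ℕ.^ m ℕ.* c          ≡⟨ cong (ℕ._* c) (ℕ.^-distribˡ-+-* p a m) ⟨
    p ℕ.^ (a ℕ.+ m) ℕ.* c              ≡⟨ cong (λ e → p ℕ.^ (e ℕ.+ m) ℕ.* c) (ℕ.*-identityˡ a) ⟨
    p ℕ.^ (1 ℕ.* a ℕ.+ m) ℕ.* c        ∎
... | no p≢x = x ℕ.^ a ℕ.* c ,
  trans (cong (x ℕ.^ a ℕ.*_) eq)
    (solve 3 (λ u v w → u :* (v :* w) := v :* (u :* w)) refl (x ℕ.^ a) (p ℕ.^ multiplicity p β ps) c) ,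
  λ p∣ → case euclidsLemma (x ℕ.^ a) c pp p∣ of λ where
    (inj₁ p∣x^a) → p≢x (prime∣prime^⇒≡ a pp xp p∣x^a)
    (inj₂ p∣c)   → p∤c p∣c
  where open +-*-Solver

-- Cancel one `p` from both sides at a time. If one exponent runs out first, `p` divides the
-- cofactor on that side.
^-valuation-unique : ∀ {p c d} .{{_ : NonZero p}} e f → p ℕ.∤ c → p ℕ.∤ d →
  p ℕ.^ e ℕ.* c ≡ p ℕ.^ f ℕ.* d → e ≡ f
^-valuation-unique zero zero _ _ _ = refl
^-valuation-unique {p} {c} {d} zero (suc f) p∤c _ eq =
  contradiction (subst (p ℕ.∣_) (trans (sym (ℕ.*-assoc p (p ℕ.^ f) d)) (trans (sym eq) (ℕ.*-identityˡ c))) (ℕ.m∣m*n _)) p∤c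
^-valuation-unique {p} {c} {d} (suc e) zero _ p∤d eq =
  contradiction (subst (p ℕ.∣_) (trans (sym (ℕ.*-assoc p (p ℕ.^ e) c)) (trans eq (ℕ.*-identityˡ d))) (ℕ.m∣m*n _)) p∤d
^-valuation-unique {p} {c} {d} (suc e) (suc f) p∤c p∤d eq =
  cong suc (^-valuation-unique e f p∤c p∤d (ℕ.*-cancelˡ-≡ _ _ p
    (trans (sym (ℕ.*-assoc p (p ℕ.^ e) c)) (trans eq (ℕ.*-assoc p (p ℕ.^ f) d)))))

multiplicity-unique : ∀ {r p} (β ps qs : Vec ℕ r) → Prime p → All Prime ps → All Prime qs →
  value β ps ≡ value β qs → multiplicity p β ps ≡ multiplicity p β qs
multiplicity-unique β ps qs pp psp qsp eq
  with c , ps≡ , p∤c ← value-multiplicity β ps pp psp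
     | d , qs≡ , p∤d ← value-multiplicity β qs pp qsp =
  ^-valuation-unique {{prime⇒nonZero pp}} _ _ p∤c p∤d (trans (sym ps≡) (trans eq qs≡))

signedSum : ∀ {r} → Vec ℤ r → Vec ℕ r → ℤ
signedSum ε β = foldr′ ℤ._+_ 0ℤ (zipWith (λ e a → e ℤ.* + a) ε β)

sign : ℕ → ℕ → ℕ → ℤ
sign p x y = + χ p x ℤ.- + χ p y

sign∈ : ∀ p x y → sign p x y List.∈ -1ℤ ∷ 0ℤ ∷ 1ℤ ∷ []
sign∈ p x y with p ℕ.≟ x | p ℕ.≟ y
... | yes _ | yes _ = there (here refl)
... | yes _ | no  _ = there (there (here refl))
... | no  _ | yes _ = here refl
... | no  _ | no  _ = there (here refl)

signs∈ : ∀ {r} p (ps qs : Vec ℕ r) → All (List._∈ -1ℤ ∷ 0ℤ ∷ 1ℤ ∷ []) (zipWith (sign p) ps qs)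
signs∈ p []       []       = []
signs∈ p (x ∷ ps) (y ∷ qs) = sign∈ p x y ∷ signs∈ p ps qs

-- The prime tested is `x` itself, so its own indicator is 1 and the difference vanishes only if
-- that of `y` is also 1.
sign-refl≡0⇒≡ : ∀ x y → sign x x y ≡ 0ℤ → x ≡ y
sign-refl≡0⇒≡ x y eq with x ℕ.≟ x | x ℕ.≟ y
... | _      | yes x≡y = x≡y
... | no x≢x | no  _   = contradiction refl x≢x
sign-refl≡0⇒≡ x y () | yes _ | no _

-- Turns equality of `p`-adic valuations into a relation of the kind that (*) speaks about.
signedSum-sign : ∀ {r} p (β ps qs : Vec ℕ r) →
  signedSum (zipWith (sign p) ps qs) β ≡ + multiplicity p β ps ℤ.- + multiplicity p β qs
signedSum-sign p []      []       []       = refl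
signedSum-sign p (a ∷ β) (x ∷ ps) (y ∷ qs) = begin
  sign p x y ℤ.* + a ℤ.+ signedSum (zipWith (sign p) ps qs) β
    ≡⟨ cong (λ t → sign p x y ℤ.* + a ℤ.+ t) (signedSum-sign p β ps qs) ⟩
  sign p x y ℤ.* + a ℤ.+ (+ m ℤ.- + n)
    ≡⟨ solve 5 (λ dx dy a m n → (dx :- dy) :* a :+ (m :- n) := (dx :* a :+ m) :- (dy :* a :+ n))
         refl (+ χ p x) (+ χ p y) (+ a) (+ m) (+ n) ⟩
  (+ χ p x ℤ.* + a ℤ.+ + m) ℤ.- (+ χ p y ℤ.* + a ℤ.+ + n)
    ≡⟨ cong₂ (λ u v → (u ℤ.+ + m) ℤ.- (v ℤ.+ + n)) (ℤ.pos-* (χ p x) a) (ℤ.pos-* (χ p y) a) ⟨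
  + (χ p x ℕ.* a ℕ.+ m) ℤ.- + (χ p y ℕ.* a ℕ.+ n) ∎
  where
  open ≡-Reasoning
  open ℤ-Solver.+-*-Solver
  m = multiplicity p β ps
  n = multiplicity p β qs

value-injective : ∀ {r} {β ps qs : Vec ℕ r} → SignedSumFree β → All Prime ps → All Prime qs →
  value β ps ≡ value β qs → ps ≡ qs
value-injective {β = β} {ps} {qs} free psp qsp eq = Pointwise-≡⇒≡ (ext λ i →
  -- The prime varies with the coordinate: testing with the entry of `ps` at `i`, the vanishing of
  -- the `i`-th sign yields the equality of entries there.
  let p = lookup ps i
      zeros = free (zipWith (sign p) ps qs) (signs∈ p ps qs)
        (trans (signedSum-sign p β ps qs)
          (ℤ.i≡j⇒i-j≡0 (cong +_ (multiplicity-unique β ps qs (All.lookup⁺ psp i) psp qsp eq))))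
  in sign-refl≡0⇒≡ p (lookup qs i)
       (trans (sym (lookup-zipWith (sign p) i ps qs)) (All.lookup⁺ zeros i)))

signedSumFree⇒unique : ∀ {r} (β : Vec ℕ r) → SignedSumFree β → UniqueRepresentations β
signedSumFree⇒unique β free n (ps , psp , n≡) =
  ps , (psp , n≡) , λ (qsp , n≡′) → value-injective free psp qsp (trans (sym n≡) n≡′)

-- Two representations from a nontrivial relation

swap₂₃ : ℤ → ℕ × ℕ
swap₂₃ (+ zero)  = 2 , 2
swap₂₃ (+ suc _) = 2 , 3
swap₂₃ -[1+ _ ]  = 3 , 2

swap₂₃-prime : ∀ e → Prime (proj₁ (swap₂₃ e)) × Prime (proj₂ (swap₂₃ e))
swap₂₃-prime (+ zero)  = from-yes (prime? 2) , from-yes (prime? 2)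
swap₂₃-prime (+ suc _) = from-yes (prime? 2) , from-yes (prime? 3)
swap₂₃-prime -[1+ _ ]  = from-yes (prime? 3) , from-yes (prime? 2)

swap₂₃-fixed : ∀ e → proj₁ (swap₂₃ e) ≡ proj₂ (swap₂₃ e) → e ≡ 0ℤ
swap₂₃-fixed (+ zero)  _ = refl
swap₂₃-fixed (+ suc _) ()
swap₂₃-fixed -[1+ _ ]  ()

-- `u` is the total exponent where the sign is 1, `v` where it is -1, and `c` is the power of 2
-- coming from the zero signs, common to both tuples.
swap₂₃-value : ∀ {r} (ε : Vec ℤ r) β → All (List._∈ -1ℤ ∷ 0ℤ ∷ 1ℤ ∷ []) ε →
  ∃[ u ] ∃[ v ] ∃[ c ] signedSum ε β ≡ + u ℤ.- + v ×
    value β (Vec.map (λ e → proj₁ (swap₂₃ e)) ε) ≡ 2 ℕ.^ u ℕ.* 3 ℕ.^ v ℕ.* c ×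
    value β (Vec.map (λ e → proj₂ (swap₂₃ e)) ε) ≡ 2 ℕ.^ v ℕ.* 3 ℕ.^ u ℕ.* c
swap₂₃-value [] [] [] = 0 , 0 , 1 , refl , refl , refl
swap₂₃-value (e ∷ ε) (a ∷ β) (e∈ ∷ ε∈)
  with u , v , c , s≡ , l≡ , r≡ ← swap₂₃-value ε β ε∈ | e∈
... | here refl = u , a ℕ.+ v , c ,
  trans (cong (λ t → -1ℤ ℤ.* + a ℤ.+ t) s≡)
    (solveℤ 3 (λ a u v → conℤ -1ℤ ⊗ a ⊕ (u ⊖ v) ⊜ u ⊖ (a ⊕ v)) refl (+ a) (+ u) (+ v)) ,
  trans (cong (3 ℕ.^ a ℕ.*_) l≡) (trans
    (solve 4 (λ x y z c → x :* (y :* z :* c) := y :* (x :* z) :* c) refl (3 ℕ.^ a) (2 ℕ.^ u) (3 ℕ.^ v) c)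
    (cong (λ t → 2 ℕ.^ u ℕ.* t ℕ.* c) (sym (ℕ.^-distribˡ-+-* 3 a v)))) ,
  trans (cong (2 ℕ.^ a ℕ.*_) r≡) (trans
    (solve 4 (λ x y z c → x :* (y :* z :* c) := x :* y :* z :* c) refl (2 ℕ.^ a) (2 ℕ.^ v) (3 ℕ.^ u) c)
    (cong (λ t → t ℕ.* 3 ℕ.^ u ℕ.* c) (sym (ℕ.^-distribˡ-+-* 2 a v))))
  where open +-*-Solver
... | there (here refl) = u , v , 2 ℕ.^ a ℕ.* c ,
  trans (cong (λ t → 0ℤ ℤ.* + a ℤ.+ t) s≡) (trans (cong (ℤ._+ (+ u ℤ.- + v)) (ℤ.*-zeroˡ (+ a))) (ℤ.+-identityˡ (+ u ℤ.- + v))) ,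
  trans (cong (2 ℕ.^ a ℕ.*_) l≡)
    (solve 4 (λ x y z c → x :* (y :* z :* c) := y :* z :* (x :* c)) refl (2 ℕ.^ a) (2 ℕ.^ u) (3 ℕ.^ v) c) ,
  trans (cong (2 ℕ.^ a ℕ.*_) r≡)
    (solve 4 (λ x y z c → x :* (y :* z :* c) := y :* z :* (x :* c)) refl (2 ℕ.^ a) (2 ℕ.^ v) (3 ℕ.^ u) c)
  where open +-*-Solver
... | there (there (here refl)) = a ℕ.+ u , v , c ,
  trans (cong (λ t → 1ℤ ℤ.* + a ℤ.+ t) s≡)
    (solveℤ 3 (λ a u v → conℤ 1ℤ ⊗ a ⊕ (u ⊖ v) ⊜ (a ⊕ u) ⊖ v) refl (+ a) (+ u) (+ v)) ,
  trans (cong (2 ℕ.^ a ℕ.*_) l≡) (trans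
    (solve 4 (λ x y z c → x :* (y :* z :* c) := x :* y :* z :* c) refl (2 ℕ.^ a) (2 ℕ.^ u) (3 ℕ.^ v) c)
    (cong (λ t → t ℕ.* 3 ℕ.^ v ℕ.* c) (sym (ℕ.^-distribˡ-+-* 2 a u)))) ,
  trans (cong (3 ℕ.^ a ℕ.*_) r≡) (trans
    (solve 4 (λ x y z c → x :* (y :* z :* c) := y :* (x :* z) :* c) refl (3 ℕ.^ a) (2 ℕ.^ v) (3 ℕ.^ u) c)
    (cong (λ t → 2 ℕ.^ v ℕ.* t ℕ.* c) (sym (ℕ.^-distribˡ-+-* 3 a u))))
  where open +-*-Solver

unique⇒signedSumFree : ∀ {r} (β : Vec ℕ r) → UniqueRepresentations β → SignedSumFree β
unique⇒signedSumFree β unique ε ε∈ sum≡0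
  with u , v , c , s≡ , l≡ , r≡ ← swap₂₃-value ε β ε∈
  -- The relation says `u ≡ v`, after which both tuples have the same value.
  with refl ← ℤ.+-injective (ℤ.i-j≡0⇒i≡j (+ u) (+ v) (trans (sym s≡) sum≡0)) =
  let ps = Vec.map (λ e → proj₁ (swap₂₃ e)) ε
      qs = Vec.map (λ e → proj₂ (swap₂₃ e)) ε
      ps-rep = All.map⁺ (All.universal (λ e → proj₁ (swap₂₃-prime e)) ε) , refl
      qs-rep = All.map⁺ (All.universal (λ e → proj₂ (swap₂₃-prime e)) ε) , trans l≡ (sym r≡)
      ws , _ , only = unique (value β ps) (ps , ps-rep)
      ps≡qs = trans (sym (only ps-rep)) (only qs-rep)
  in All.lookup⁻ λ i → swap₂₃-fixed (lookup ε i) (trans (sym (lookup-map i _ ε))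
       (trans (cong (λ xs → lookup xs i) ps≡qs) (lookup-map i _ ε)))

-- Unordered sums

sum : (A → ℚ) → List A → ℚ
sum w []       = 0ℚ
sum w (x ∷ xs) = w x + sum w xs

approx-Σ : ∀ f F k → approx (Σ[ F ] f) k ≡ sum (λ n → approx (f n) k) F
approx-Σ f []      k = refl
approx-Σ f (n ∷ F) k = cong (λ t → approx (f n) k + t) (approx-Σ f F k)

sum-cong : ∀ {v w : A → ℚ} → (∀ x → v x ≡ w x) → ∀ xs → sum v xs ≡ sum w xs
sum-cong v≡w []       = refl
sum-cong v≡w (x ∷ xs) = cong₂ _+_ (v≡w x) (sum-cong v≡w xs)

sum-++ : ∀ (w : A → ℚ) xs ys → sum w (xs ++ ys) ≡ sum w xs + sum w ys
sum-++ w []       ys = sym (ℚ.+-identityˡ (sum w ys))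
sum-++ w (x ∷ xs) ys = trans (cong (λ t → w x + t) (sum-++ w xs ys)) (sym (ℚ.+-assoc (w x) (sum w xs) (sum w ys)))

sum-map : ∀ (w : B → ℚ) (g : A → B) xs → sum w (map g xs) ≡ sum (λ x → w (g x)) xs
sum-map w g []       = refl
sum-map w g (x ∷ xs) = cong (λ t → w (g x) + t) (sum-map w g xs)

sum-*ˡ : ∀ c (w : A → ℚ) xs → sum (λ x → c * w x) xs ≡ c * sum w xs
sum-*ˡ c w []       = sym (ℚ.*-zeroʳ c)
sum-*ˡ c w (x ∷ xs) = trans (cong (λ t → c * w x + t) (sum-*ˡ c w xs)) (sym (ℚ.*-distribˡ-+ c (w x) (sum w xs)))

sum-cartesianProduct : ∀ (v : A → ℚ) (w : B → ℚ) xs ys →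
  sum (λ (x , y) → v x * w y) (cartesianProduct xs ys) ≡ sum v xs * sum w ys
sum-cartesianProduct v w []       ys = sym (ℚ.*-zeroˡ (sum w ys))
sum-cartesianProduct v w (x ∷ xs) ys = begin
  sum vw (map (x ,_) ys ++ cartesianProduct xs ys)
    ≡⟨ sum-++ vw (map (x ,_) ys) (cartesianProduct xs ys) ⟩
  sum vw (map (x ,_) ys) + sum vw (cartesianProduct xs ys)
    ≡⟨ cong₂ _+_ (trans (sum-map vw (x ,_) ys) (sum-*ˡ (v x) w ys)) (sum-cartesianProduct v w xs ys) ⟩
  v x * sum w ys + sum v xs * sum w ys
    ≡⟨ ℚ.*-distribʳ-+ (sum w ys) (v x) (sum v xs) ⟨
  (v x + sum v xs) * sum w ys ∎
  where
  open ≡-Reasoning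
  vw = λ (x , y) → v x * w y

sum-nonNeg : ∀ {w : A → ℚ} → (∀ x → 0ℚ ℚ.≤ w x) → ∀ xs → 0ℚ ℚ.≤ sum w xs
sum-nonNeg 0≤w []       = ℚ.≤-refl
sum-nonNeg 0≤w (x ∷ xs) = ℚ.+-mono-≤ (0≤w x) (sum-nonNeg 0≤w xs)

-- Remove one occurrence of the head from `ys`; since the head does not recur in `xs`, the rest of
-- `xs` is still covered. The list `ys` may have repetitions, so it can be a concatenation of
-- overlapping blocks.
sum-mono-⊆ : ∀ {w : A → ℚ} {xs ys} → (∀ x → 0ℚ ℚ.≤ w x) → Unique xs → xs ⊆ ys →
  sum w xs ℚ.≤ sum w ys
sum-mono-⊆ {ys = ys} 0≤w []            _  = sum-nonNeg 0≤w ys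
sum-mono-⊆ {w = w} {x ∷ xs} 0≤w (x∉xs ∷ xs!) xs⊆ys
  with us , vs , refl ← ∈-∃++ (xs⊆ys (here refl)) = begin
  w x + sum w xs                ≤⟨ ℚ.+-monoʳ-≤ (w x) (sum-mono-⊆ 0≤w xs! xs⊆us++vs) ⟩
  w x + sum w (us ++ vs)        ≡⟨ cong (λ t → w x + t) (sum-++ w us vs) ⟩
  w x + (sum w us + sum w vs)   ≡⟨ solve 3 (λ x u v → x :+ (u :+ v) := u :+ (x :+ v)) refl (w x) (sum w us) (sum w vs) ⟩
  sum w us + (w x + sum w vs)   ≡⟨ sum-++ w us (x ∷ vs) ⟨
  sum w (us ++ x ∷ vs)          ∎
  where
  open ℚ.≤-Reasoning
  open ℚ-Solver.+-*-Solver
  xs⊆us++vs : xs ⊆ us ++ vs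
  xs⊆us++vs y∈xs with ∈-++⁻ us (xs⊆ys (there y∈xs))
  ... | inj₁ y∈us         = ∈-++⁺ˡ y∈us
  ... | inj₂ (here y≡x)   = contradiction (sym y≡x) (ListAll.lookup x∉xs y∈xs)
  ... | inj₂ (there y∈vs) = ∈-++⁺ʳ us y∈vs

sum-close : ∀ (v w : A → ℕ → ℚ) xs →
  (∀ {x} → x List.∈ xs → ∀ ε .{{_ : Positive ε}} → ∃[ N ] ∀ k → N ℕ.≤ k → ∣ v x k - w x k ∣ ℚ.≤ ε) →
  ∀ ε .{{_ : Positive ε}} →
  ∃[ N ] ∀ k → N ℕ.≤ k → ∣ sum (λ x → v x k) xs - sum (λ x → w x k) xs ∣ ℚ.≤ ε
sum-close v w []       _     ε = 0 , λ _ _ → ℚ.<⇒≤ (ℚ.positive⁻¹ ε)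
sum-close v w (x ∷ xs) close ε =
  let instance _ = half-pos ε
      M , head≤ = close (here refl) (½ * ε)
      N , tail≤ = sum-close v w xs (λ x∈xs → close (there x∈xs)) (½ * ε)
  in M ℕ.⊔ N , λ k k≥ → ℚ.≤-trans
       (+-close (v x k) (w x k) (sum (λ y → v y k) xs) (sum (λ y → w y k) xs))
       (subst (_ ℚ.≤_) (split ε) (ℚ.+-mono-≤
         (head≤ k (ℕ.m⊔n≤o⇒m≤o M N k≥)) (tail≤ k (ℕ.m⊔n≤o⇒n≤o M N k≥))))

-- Series with uniformly small tails

NonNegative : (ℕ → ℝ) → Set
NonNegative f = ∀ n k → 0ℚ ℚ.≤ approx (f n) k

-- One `N` serves every approximation index `k`; this is what makes the diagonal sequence in
-- `series` Cauchy.
UniformTails : (ℕ → ℝ) → Set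
UniformTails f = ∀ ε .{{_ : Positive ε}} →
  ∃[ N ] ∀ F → Unique F → ListAll.All (N ℕ.≤_) F → ∀ k → sum (λ n → approx (f n) k) F ℚ.≤ ε

below : {S : ℕ → Set} → Decidable S → ℕ → List ℕ
below S? N = filter S? (upTo N)

below-! : ∀ {S} (S? : Decidable S) N → Unique (below S? N)
below-! S? N = Unique.filter⁺ S? (Unique.upTo⁺ N)

∈-below⁺ : ∀ {S} (S? : Decidable S) {N n} → n ℕ.< N → S n → n List.∈ below S? N
∈-below⁺ S? n<N = ∈-filter⁺ S? (∈-upTo⁺ n<N)

below-all : ∀ {S} (S? : Decidable S) N → ListAll.All S (below S? N)
below-all S? N = ListAll.tabulate (λ n∈ → proj₂ (∈-filter⁻ S? {xs = upTo N} n∈))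

below-mono : ∀ {S} (S? : Decidable S) {M N} → M ℕ.≤ N → below S? M ⊆ below S? N
below-mono S? M≤N n∈ with n∈upTo , Sn ← ∈-filter⁻ S? n∈ =
  ∈-below⁺ S? (ℕ.<-≤-trans (∈-upTo⁻ n∈upTo) M≤N) Sn

module _ {S : ℕ → Set} (S? : Decidable S) (f : ℕ → ℝ) (0≤f : NonNegative f) where

  -- Elements of `F` below `N` already lie in `below S? N`, and the others form a tail of weight at
  -- most `ε`; nonnegativity gives the other inequality.
  partialSum-close : ∀ {N ε F} →
    (∀ F → Unique F → ListAll.All (N ℕ.≤_) F → ∀ k → sum (λ n → approx (f n) k) F ℚ.≤ ε) →
    0ℚ ℚ.≤ ε → FiniteSubset S F → below S? N ⊆ F → ∀ k →
    ∣ sum (λ n → approx (f n) k) F - sum (λ n → approx (f n) k) (below S? N) ∣ ℚ.≤ ε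
  partialSum-close {N} {ε} {F} tail 0≤ε (F! , F⊆S) F₀⊆F k = ∣-∣≤ upper lower
    where
    open ℚ.≤-Reasoning
    w = λ n → approx (f n) k
    F₁ = filter (N ℕ.≤?_) F
    F⊆ : F ⊆ below S? N ++ F₁
    F⊆ {n} n∈F with N ℕ.≤? n
    ... | yes N≤n = ∈-++⁺ʳ (below S? N) (∈-filter⁺ (N ℕ.≤?_) n∈F N≤n)
    ... | no  N≰n = ∈-++⁺ˡ (∈-below⁺ S? (ℕ.≰⇒> N≰n) (ListAll.lookup F⊆S n∈F))
    upper = begin
      sum w F                           ≤⟨ sum-mono-⊆ (λ n → 0≤f n k) F! F⊆ ⟩
      sum w (below S? N ++ F₁)          ≡⟨ sum-++ w (below S? N) F₁ ⟩
      sum w (below S? N) + sum w F₁     ≤⟨ ℚ.+-monoʳ-≤ (sum w (below S? N)) (tail F₁ (Unique.filter⁺ (N ℕ.≤?_) F!)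
                                             (ListAll.all-filter (N ℕ.≤?_) F) k) ⟩
      sum w (below S? N) + ε            ∎
    lower = begin
      sum w (below S? N)  ≤⟨ sum-mono-⊆ (λ n → 0≤f n k) (below-! S? N) F₀⊆F ⟩
      sum w F             ≡⟨ ℚ.+-identityʳ (sum w F) ⟨
      sum w F + 0ℚ        ≤⟨ ℚ.+-monoʳ-≤ (sum w F) 0≤ε ⟩
      sum w F + ε         ∎

  series : UniformTails f → ℝ
  series tails .approx k = sum (λ n → approx (f n) k) (below S? k)
  series tails .cauchy ε =
    let instance
          ε/2>0 = half-pos ε
          ε/4>0 = half-pos (½ * ε)
        -- A quarter of `ε` for the tail at each of the two indices, and half for the change of the
        -- fixed finite sum over `F₀` between them.
        δ = ½ * (½ * ε)
        N , tail = tails δ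
        F₀ = below S? N
        M , near = cauchy (Σ[ F₀ ] f) (½ * ε)
        s = λ k F → sum (λ n → approx (f n) k) F
        near-F₀ = λ k k≥ → partialSum-close tail (ℚ.<⇒≤ (ℚ.positive⁻¹ δ))
          (below-! S? k , below-all S? k) (below-mono S? (ℕ.m⊔n≤o⇒n≤o M N k≥)) k
    in M ℕ.⊔ N , λ m n m≥ n≥ → begin
      ∣ s m (below S? m) - s n (below S? n) ∣
        ≤⟨ triangle (s m (below S? m)) (s m F₀) (s n (below S? n)) ⟩
      ∣ s m (below S? m) - s m F₀ ∣ + ∣ s m F₀ - s n (below S? n) ∣
        ≤⟨ ℚ.+-monoʳ-≤ ∣ s m (below S? m) - s m F₀ ∣ (triangle (s m F₀) (s n F₀) (s n (below S? n))) ⟩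
      ∣ s m (below S? m) - s m F₀ ∣ + (∣ s m F₀ - s n F₀ ∣ + ∣ s n F₀ - s n (below S? n) ∣)
        ≤⟨ ℚ.+-mono-≤ (near-F₀ m m≥) (ℚ.+-mono-≤
             (subst₂ (λ p q → ∣ p - q ∣ ℚ.≤ ½ * ε) (approx-Σ f F₀ m) (approx-Σ f F₀ n)
               (near m n (ℕ.m⊔n≤o⇒m≤o M N m≥) (ℕ.m⊔n≤o⇒m≤o M N n≥)))
             (subst (ℚ._≤ δ) (∣-∣-swap (s n (below S? n)) (s n F₀)) (near-F₀ n n≥))) ⟩
      δ + (½ * ε + δ)
        ≡⟨ solve 1 (λ e → con ½ :* (con ½ :* e) :+ (con ½ :* e :+ con ½ :* (con ½ :* e)) := e) refl ε ⟩
      ε ∎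
    where
    open ℚ.≤-Reasoning
    open ℚ-Solver.+-*-Solver

  -- For `k` at least `N`, both `F` and `below S? k` contain `F₀`, so at stage `k` each of their
  -- sums is within half of `ε` of that over `F₀`.
  series-hasSum : (tails : UniformTails f) → HasSum S f (series tails)
  series-hasSum tails ε =
    let instance _ = half-pos ε
        N , tail = tails (½ * ε)
        F₀ = below S? N
        s = λ k F → sum (λ n → approx (f n) k) F
        near-F₀ = λ {F} → partialSum-close {F = F} tail (ℚ.<⇒≤ (ℚ.positive⁻¹ (½ * ε)))
    in F₀ , (below-! S? N , below-all S? N) , λ F F⊆S F₀⊆F → N , λ k k≥ → begin
      ∣ approx (Σ[ F ] f) k - s k (below S? k) ∣
        ≡⟨ cong (λ t → ∣ t - s k (below S? k) ∣) (approx-Σ f F k) ⟩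
      ∣ s k F - s k (below S? k) ∣
        ≤⟨ triangle (s k F) (s k F₀) (s k (below S? k)) ⟩
      ∣ s k F - s k F₀ ∣ + ∣ s k F₀ - s k (below S? k) ∣
        ≤⟨ ℚ.+-mono-≤ (near-F₀ F⊆S F₀⊆F k)
             (subst (ℚ._≤ ½ * ε) (∣-∣-swap (s k (below S? k)) (s k F₀))
               (near-F₀ (below-! S? k , below-all S? k) (below-mono S? k≥) k)) ⟩
      ½ * ε + ½ * ε
        ≡⟨ split ε ⟩
      ε ∎
    where open ℚ.≤-Reasoning

  ∃-hasSum : UniformTails f → ∃[ s ] HasSum S f s
  ∃-hasSum tails = series tails , series-hasSum tails

-- The prime zeta function

^-cancelʳ-≤ : ∀ b .{{_ : NonZero b}} {x y} → x ℕ.^ b ℕ.≤ y ℕ.^ b → x ℕ.≤ y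
^-cancelʳ-≤ b {x} {y} x^b≤y^b with x ℕ.≤? y
... | yes x≤y = x≤y
... | no  x≰y = contradiction x^b≤y^b (ℕ.<⇒≱ (ℕ.^-monoˡ-< b (ℕ.≰⇒> x≰y)))

n<2^n : ∀ n → n ℕ.< 2 ℕ.^ n
n<2^n zero    = ℕ.≤-refl
n<2^n (suc n) = ℕ.≤-trans (ℕ.+-mono-≤ (ℕ.m^n>0 2 n) (n<2^n n))
  (ℕ.≤-reflexive (cong (2 ℕ.^ n ℕ.+_) (sym (ℕ.+-identityʳ (2 ℕ.^ n)))))

floor-spec : ∀ K n a b .{{_ : NonZero b}} → ⌊ K * n ^-[ a / b ]⌋ ℕ.^ b ℕ.* n ℕ.^ a ℕ.≤ K ℕ.^ b
floor-spec K n a b@(suc _) = largest-holds (λ m → m ℕ.^ b ℕ.* n ℕ.^ a ℕ.≤? K ℕ.^ b) K ℕ.z≤n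

rootApprox : ℕ → ℕ → ℕ → ℕ → ℚ
rootApprox a b n k = + ⌊ suc k * n ^-[ a / b ]⌋ / suc k

-- Deciding whether two separately elaborated copies of the real number n ^-[ a / b ] are equal unfolds
-- its Cauchy proof and is prohibitively slow. Roots are therefore abstract functions characterised by
-- IsRoot, and the concrete root is inserted in theorem2 with its NonZero instance given explicitly.
IsRoot : ℕ → ℕ → (ℕ → ℝ) → Set
IsRoot a b f = ∀ n k → approx (f n) k ≡ rootApprox a b n k

rootApprox-nonNeg : ∀ a b n k → 0ℚ ℚ.≤ rootApprox a b n k
rootApprox-nonNeg a b n k = /-mono-≤ 0 1 ⌊ suc k * n ^-[ a / b ]⌋ (suc k) ℕ.z≤n

isRoot-nonNeg : ∀ a b {f} → IsRoot a b f → NonNegative f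
isRoot-nonNeg a b isRoot n k = subst (0ℚ ℚ.≤_) (sym (isRoot n k)) (rootApprox-nonNeg a b n k)

-- Compare `b`-th powers: with `m` the floor and `K` the denominator, m^b 2^(bJ(b+1)) ≤ m^b 2^(bJa)
-- ≤ m^b n^a ≤ K^b.
rootApprox-block : ∀ a b J {n} .{{_ : NonZero b}} .{{_ : NonZero (2 ℕ.^ (J ℕ.* suc b))}} → b ℕ.< a →
  2 ℕ.^ (b ℕ.* J) ℕ.≤ n → ∀ k → rootApprox a b n k ℚ.≤ + 1 / 2 ℕ.^ (J ℕ.* suc b)
rootApprox-block a b J {n} b<a n≥ k = /-mono-≤ m (suc k) 1 (2 ℕ.^ (J ℕ.* suc b))
  (ℕ.≤-trans (^-cancelʳ-≤ b root) (ℕ.≤-reflexive (sym (ℕ.*-identityˡ (suc k)))))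
  where
  open ℕ.≤-Reasoning
  m = ⌊ suc k * n ^-[ a / b ]⌋
  root : (m ℕ.* 2 ℕ.^ (J ℕ.* suc b)) ℕ.^ b ℕ.≤ suc k ℕ.^ b
  root = begin
    (m ℕ.* 2 ℕ.^ (J ℕ.* suc b)) ℕ.^ b          ≡⟨ ^-distribʳ-* m (2 ℕ.^ (J ℕ.* suc b)) b ⟩
    m ℕ.^ b ℕ.* (2 ℕ.^ (J ℕ.* suc b)) ℕ.^ b    ≡⟨ cong (m ℕ.^ b ℕ.*_) (ℕ.^-*-assoc 2 (J ℕ.* suc b) b) ⟩
    m ℕ.^ b ℕ.* 2 ℕ.^ (J ℕ.* suc b ℕ.* b)      ≡⟨ cong (λ e → m ℕ.^ b ℕ.* 2 ℕ.^ e)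
                                                    (solve 2 (λ J b → J :* (con 1 :+ b) :* b := b :* J :* (con 1 :+ b)) refl J b) ⟩
    m ℕ.^ b ℕ.* 2 ℕ.^ (b ℕ.* J ℕ.* suc b)      ≤⟨ ℕ.*-monoʳ-≤ (m ℕ.^ b) (ℕ.^-monoʳ-≤ 2 (ℕ.*-monoʳ-≤ (b ℕ.* J) b<a)) ⟩
    m ℕ.^ b ℕ.* 2 ℕ.^ (b ℕ.* J ℕ.* a)          ≡⟨ cong (m ℕ.^ b ℕ.*_) (ℕ.^-*-assoc 2 (b ℕ.* J) a) ⟨
    m ℕ.^ b ℕ.* (2 ℕ.^ (b ℕ.* J)) ℕ.^ a        ≤⟨ ℕ.*-monoʳ-≤ (m ℕ.^ b) (ℕ.^-monoˡ-≤ a n≥) ⟩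
    m ℕ.^ b ℕ.* n ℕ.^ a                        ≤⟨ floor-spec (suc k) n a b ⟩
    suc k ℕ.^ b                                ∎
    where open +-*-Solver

sum-≤-length : ∀ {w : A → ℚ} {d} .{{_ : NonZero d}} xs → (∀ {x} → x List.∈ xs → w x ℚ.≤ + 1 / d) →
  sum w xs ℚ.≤ + length xs / d
sum-≤-length {d = d} []       _   = /-mono-≤ 0 1 0 d ℕ.z≤n
sum-≤-length {d = d} (x ∷ xs) w≤ = ℚ.≤-trans
  (ℚ.+-mono-≤ (w≤ (here refl)) (sum-≤-length xs (λ x∈xs → w≤ (there x∈xs))))
  (ℚ.≤-reflexive (sym (/-distrib-+ 1 (length xs) d)))

-- Contains [2^(bj), 2^(b(j+1))); only an upper bound is needed, so the overshoot is harmless.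
block : ℕ → ℕ → List ℕ
block b j = map (2 ℕ.^ (b ℕ.* j) ℕ.+_) (upTo (2 ℕ.^ (b ℕ.* suc j)))

blocks : ℕ → ℕ → ℕ → List ℕ
blocks b J zero    = []
blocks b J (suc d) = block b J ++ blocks b (suc J) d

∈-blocks : ∀ b J d {n} → 2 ℕ.^ (b ℕ.* J) ℕ.≤ n → n ℕ.< 2 ℕ.^ (b ℕ.* (d ℕ.+ J)) → n List.∈ blocks b J d
∈-blocks b J zero    n≥ n< = contradiction n≥ (ℕ.<⇒≱ n<)
∈-blocks b J (suc d) {n} n≥ n< with 2 ℕ.^ (b ℕ.* suc J) ℕ.≤? n
... | yes n≥′ = ∈-++⁺ʳ (block b J) (∈-blocks b (suc J) d n≥′
                  (subst (λ e → n ℕ.< 2 ℕ.^ (b ℕ.* e)) (sym (ℕ.+-suc d J)) n<))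
... | no  n≱  = ∈-++⁺ˡ (subst (List._∈ block b J) (ℕ.m+[n∸m]≡n n≥)
                  (∈-map⁺ (2 ℕ.^ (b ℕ.* J) ℕ.+_) (∈-upTo⁺ (ℕ.≤-<-trans (ℕ.m∸n≤m n (2 ℕ.^ (b ℕ.* J))) (ℕ.≰⇒> n≱)))))

-- There are 2^(b(J+1)) terms, each at most 2^(-J(b+1)), which multiplies out to 2^(b-J).
sum-block : ∀ a b J .{{_ : NonZero b}} .{{_ : NonZero (2 ℕ.^ J)}} → b ℕ.< a → ∀ k →
  sum (λ n → rootApprox a b n k) (block b J) ℚ.≤ + (2 ℕ.^ b) / 2 ℕ.^ J
sum-block a b J b<a k = begin
  sum w (block b J)
    ≤⟨ sum-≤-length (block b J) bound ⟩
  + length (block b J) / 2 ℕ.^ (J ℕ.* suc b)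
    ≡⟨ cong (λ l → + l / 2 ℕ.^ (J ℕ.* suc b)) (trans (length-map _ (upTo M)) (length-upTo M)) ⟩
  + M / 2 ℕ.^ (J ℕ.* suc b)
    ≤⟨ /-mono-≤ M (2 ℕ.^ (J ℕ.* suc b)) (2 ℕ.^ b) (2 ℕ.^ J) (ℕ.≤-reflexive powers) ⟩
  + (2 ℕ.^ b) / 2 ℕ.^ J ∎
  where
  open ℚ.≤-Reasoning
  w = λ n → rootApprox a b n k
  M = 2 ℕ.^ (b ℕ.* suc J)
  instance 2^≢0 = ℕ.m^n≢0 2 (J ℕ.* suc b)
  bound : ∀ {n} → n List.∈ block b J → w n ℚ.≤ + 1 / 2 ℕ.^ (J ℕ.* suc b)
  bound n∈ with i , _ , refl ← ∈-map⁻ (2 ℕ.^ (b ℕ.* J) ℕ.+_) n∈ =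
    rootApprox-block a b J b<a (ℕ.m≤m+n _ i) k
  powers : M ℕ.* 2 ℕ.^ J ≡ 2 ℕ.^ b ℕ.* 2 ℕ.^ (J ℕ.* suc b)
  powers = trans (sym (ℕ.^-distribˡ-+-* 2 (b ℕ.* suc J) J)) (trans
    (cong (2 ℕ.^_) (solve 2 (λ b J → b :* (con 1 :+ J) :+ J := b :+ J :* (con 1 :+ b)) refl b J))
    (ℕ.^-distribˡ-+-* 2 b (J ℕ.* suc b)))
    where open +-*-Solver

-- A geometric series: the bound is twice that of the first block, and the bound for the later
-- blocks is half of this, so it equals the bound for the first block.
sum-blocks : ∀ a b J d .{{_ : NonZero b}} .{{_ : NonZero (2 ℕ.^ J)}} → b ℕ.< a → ∀ k →
  sum (λ n → rootApprox a b n k) (blocks b J d) ℚ.≤ + (2 ℕ.^ b ℕ.+ 2 ℕ.^ b) / 2 ℕ.^ J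
sum-blocks a b J zero    b<a k = /-mono-≤ 0 1 (2 ℕ.^ b ℕ.+ 2 ℕ.^ b) (2 ℕ.^ J) ℕ.z≤n
sum-blocks a b J (suc d) b<a k = begin
  sum w (block b J ++ blocks b (suc J) d)
    ≡⟨ sum-++ w (block b J) (blocks b (suc J) d) ⟩
  sum w (block b J) + sum w (blocks b (suc J) d)
    ≤⟨ ℚ.+-mono-≤ (sum-block a b J b<a k) (sum-blocks a b (suc J) d b<a k) ⟩
  + (2 ℕ.^ b) / 2 ℕ.^ J + + (2 ℕ.^ b ℕ.+ 2 ℕ.^ b) / 2 ℕ.^ suc J
    ≤⟨ ℚ.+-monoʳ-≤ (+ (2 ℕ.^ b) / 2 ℕ.^ J)
         (/-mono-≤ (2 ℕ.^ b ℕ.+ 2 ℕ.^ b) (2 ℕ.^ suc J) (2 ℕ.^ b) (2 ℕ.^ J) (ℕ.≤-reflexive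
           (solve 2 (λ x y → (x :+ x) :* y := x :* (con 2 :* y)) refl (2 ℕ.^ b) (2 ℕ.^ J)))) ⟩
  + (2 ℕ.^ b) / 2 ℕ.^ J + + (2 ℕ.^ b) / 2 ℕ.^ J
    ≡⟨ /-distrib-+ (2 ℕ.^ b) (2 ℕ.^ b) (2 ℕ.^ J) ⟨
  + (2 ℕ.^ b ℕ.+ 2 ℕ.^ b) / 2 ℕ.^ J ∎
  where
  open ℚ.≤-Reasoning
  open +-*-Solver
  w = λ n → rootApprox a b n k
  instance 2^≢0 = ℕ.m^n≢0 2 (suc J)

∃-upper-bound : ∀ (F : List ℕ) → ∃[ L ] ListAll.All (ℕ._≤ L) F
∃-upper-bound []      = 0 , ListAll.[]
∃-upper-bound (n ∷ F) with L , F≤L ← ∃-upper-bound F =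
  n ℕ.⊔ L , ℕ.m≤m⊔n n L ListAll.∷ ListAll.map (λ ≤L → ℕ.≤-trans ≤L (ℕ.m≤n⊔m n L)) F≤L

isRoot-uniformTails : ∀ a b {f} .{{_ : NonZero b}} → b ℕ.< a → IsRoot a b f → UniformTails f
isRoot-uniformTails a b {f} b<a isRoot ε = 2 ℕ.^ (b ℕ.* J) , λ F F! F≥ k →
  let L , F≤L = ∃-upper-bound F
      w = λ n → rootApprox a b n k
  in begin
    sum (λ n → approx (f n) k) F
      ≡⟨ sum-cong (λ n → isRoot n k) F ⟩
    sum w F
      -- `L` blocks reach beyond `F`, because L < 2^L ≤ 2^(b(L+J)).
      ≤⟨ sum-mono-⊆ (λ n → rootApprox-nonNeg a b n k) F! (λ n∈F → ∈-blocks b J L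
           (ListAll.lookup F≥ n∈F) (ℕ.<-≤-trans (ℕ.≤-<-trans (ListAll.lookup F≤L n∈F) (n<2^n L))
             (ℕ.^-monoʳ-≤ 2 (ℕ.≤-trans (ℕ.m≤m+n L J) (ℕ.m≤n*m (L ℕ.+ J) b))))) ⟩
    sum w (blocks b J L)
      ≤⟨ sum-blocks a b J L b<a k ⟩
    + (2 ℕ.^ b ℕ.+ 2 ℕ.^ b) / 2 ℕ.^ J
      ≤⟨ /-mono-≤ (2 ℕ.^ b ℕ.+ 2 ℕ.^ b) (2 ℕ.^ J) 1 (ℚ.↧ₙ ε)
           (ℕ.≤-trans (ℕ.<⇒≤ (n<2^n J)) (ℕ.≤-reflexive (sym (ℕ.*-identityˡ (2 ℕ.^ J))))) ⟩
    + 1 / ℚ.↧ₙ ε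
      ≤⟨ 1/denominator≤ ε ⟩
    ε ∎
  where
  open ℚ.≤-Reasoning
  -- Chosen so that J < 2^J bounds the tail 2^(b+1) / 2^J by the reciprocal of the denominator of
  -- `ε`.
  J = (2 ℕ.^ b ℕ.+ 2 ℕ.^ b) ℕ.* ℚ.↧ₙ ε
  instance 2^≢0 = ℕ.m^n≢0 2 J

primeSum : ∀ a b {f} .{{_ : NonZero b}} → b ℕ.< a → IsRoot a b f → ∃[ P ] HasSum Prime f P
primeSum a b {f} b<a isRoot =
  ∃-hasSum prime? f (isRoot-nonNeg a b {f} isRoot) (isRoot-uniformTails a b {f} b<a isRoot)

-- Products of unordered sums

p≤p+q : ∀ p q .{{_ : ℚ.NonNegative q}} → p ℚ.≤ p + q
p≤p+q p q = subst (ℚ._≤ p + q) (ℚ.+-identityʳ p) (ℚ.+-monoʳ-≤ p (ℚ.nonNegative⁻¹ q))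

0≤p*q : ∀ {p q} → 0ℚ ℚ.≤ p → 0ℚ ℚ.≤ q → 0ℚ ℚ.≤ p * q
0≤p*q {p} {q} 0≤p 0≤q = ℚ.nonNegative⁻¹ (p * q) {{ℚ.nonNeg*nonNeg⇒nonNeg p {{ℚ.nonNegative 0≤p}} q {{ℚ.nonNegative 0≤q}}}}

∣-∣≤⇒≤+ : ∀ p q {δ} → ∣ p - q ∣ ℚ.≤ δ → p ℚ.≤ q + δ
∣-∣≤⇒≤+ p q {δ} p-q≤δ = subst (ℚ._≤ q + δ)
  (solve 2 (λ p q → q :+ (p :- q) := p) refl p q)
  (ℚ.+-monoʳ-≤ q (ℚ.≤-trans (p≤∣p∣ (p - q)) p-q≤δ))
  where
  open ℚ-Solver.+-*-Solver
  p≤∣p∣ : ∀ p → p ℚ.≤ ∣ p ∣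
  p≤∣p∣ p with ℚ.≤-total 0ℚ p
  ... | inj₁ 0≤p = ℚ.≤-reflexive (sym (ℚ.0≤p⇒∣p∣≡p 0≤p))
  ... | inj₂ p≤0 = ℚ.≤-trans p≤0 (ℚ.0≤∣p∣ p)

squeeze : ∀ {l z u} c {δ} → l ℚ.≤ z → z ℚ.≤ u → ∣ l - c ∣ ℚ.≤ δ → ∣ u - c ∣ ℚ.≤ δ → ∣ z - c ∣ ℚ.≤ δ
squeeze {l} {z} {u} c {δ} l≤z z≤u l≈c u≈c = ∣-∣≤
  (ℚ.≤-trans z≤u (∣-∣≤⇒≤+ u c u≈c))
  (ℚ.≤-trans (∣-∣≤⇒≤+ c l (subst (ℚ._≤ δ) (∣-∣-swap l c) l≈c)) (ℚ.+-monoˡ-≤ δ l≤z))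

-- The factors are arbitrary rationals near the `k`-th approximations, with `δ` independent of `k`,
-- so that partial sums over different finite sets can be substituted.
*-continuous : ∀ s t ε .{{_ : Positive ε}} → ∃[ δ ] Positive δ × ∃[ N ] ∀ k → N ℕ.≤ k → ∀ x y →
  ∣ x - approx s k ∣ ℚ.≤ δ → ∣ y - approx t k ∣ ℚ.≤ δ → ∣ x * y - approx (s *ℝ t) k ∣ ℚ.≤ ε
*-continuous s t ε =
  let A , K , 0≤A , s≤A = bounded s
      B , L , 0≤B , t≤B = bounded t
      C = A + 1ℚ + B
      -- Dividing `ε` by `D` gives a `δ` that is at most 1, which bounds `x` by A + 1, and also
      -- satisfies C δ ≤ ε.
      D = C + ε
      instance
        A≥0 = ℚ.nonNegative 0≤A
        B≥0 = ℚ.nonNegative 0≤B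
        A+1>0 = ℚ.nonNeg+pos⇒pos A 1ℚ
        A+1≥0 = ℚ.pos⇒nonNeg (A + 1ℚ)
        C>0 = ℚ.pos+nonNeg⇒pos (A + 1ℚ) B
        C≥0 = ℚ.pos⇒nonNeg C
        D>0 = ℚ.nonNeg+pos⇒pos C ε
        D≢0 = ℚ.pos⇒nonZero D
        1/D>0 = ℚ.1/pos⇒pos D
        1/D≥0 = ℚ.pos⇒nonNeg (1/ D)
        δ>0 = ℚ.pos*pos⇒pos (1/ D) ε
        ε≥0 = ℚ.pos⇒nonNeg ε
      δ = 1/ D * ε
      instance δ≥0 = ℚ.pos⇒nonNeg δ
      δ≤1 : δ ℚ.≤ 1ℚ
      δ≤1 = begin
        1/ D * ε  ≤⟨ ℚ.*-monoˡ-≤-nonNeg (1/ D) (subst (ε ℚ.≤_) (ℚ.+-comm ε C) (p≤p+q ε C)) ⟩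
        1/ D * D  ≡⟨ ℚ.*-inverseˡ D ⟩
        1ℚ        ∎
      bound : (A + 1ℚ) * δ + B * δ ℚ.≤ ε
      bound = begin
        (A + 1ℚ) * δ + B * δ  ≡⟨ ℚ.*-distribʳ-+ δ (A + 1ℚ) B ⟨
        C * δ                 ≤⟨ ℚ.*-monoʳ-≤-nonNeg δ (p≤p+q C ε) ⟩
        D * (1/ D * ε)        ≡⟨ ℚ.*-assoc D (1/ D) ε ⟨
        D * 1/ D * ε          ≡⟨ cong (_* ε) (ℚ.*-inverseʳ D) ⟩
        1ℚ * ε                ≡⟨ ℚ.*-identityˡ ε ⟩
        ε                     ∎
  in δ , δ>0 , K ℕ.⊔ L , λ k k≥ x y x≈s y≈t →
     let s≤ = s≤A k (ℕ.m⊔n≤o⇒m≤o K L k≥)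
         t≤ = t≤B k (ℕ.m⊔n≤o⇒n≤o K L k≥)
         x≤ : ∣ x ∣ ℚ.≤ A + 1ℚ
         x≤ = begin
           ∣ x ∣                                ≡⟨ cong ∣_∣ (solve 2 (λ s x → s :+ (x :- s) := x) refl (approx s k) x) ⟨
           ∣ approx s k + (x - approx s k) ∣    ≤⟨ ℚ.∣p+q∣≤∣p∣+∣q∣ (approx s k) (x - approx s k) ⟩
           ∣ approx s k ∣ + ∣ x - approx s k ∣  ≤⟨ ℚ.+-mono-≤ s≤ (ℚ.≤-trans x≈s δ≤1) ⟩
           A + 1ℚ                               ∎
     in begin
       ∣ x * y - approx s k * approx t k ∣
         ≤⟨ *-close x (approx s k) y (approx t k) ⟩
       ∣ x ∣ * ∣ y - approx t k ∣ + ∣ approx t k ∣ * ∣ x - approx s k ∣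
         ≤⟨ ℚ.+-mono-≤ (*-mono-∣∣ x (y - approx t k) x≤ y≈t) (*-mono-∣∣ (approx t k) (x - approx s k) t≤ x≈s) ⟩
       (A + 1ℚ) * δ + B * δ
         ≤⟨ bound ⟩
       ε ∎
  where
  open ℚ.≤-Reasoning
  open ℚ-Solver.+-*-Solver

FiniteSubset-∪ : ∀ {S} F G → ListAll.All S F → ListAll.All S G → FiniteSubset S (deduplicate ℕ._≟_ (F ++ G))
FiniteSubset-∪ F G F⊆S G⊆S = deduplicate-! ℕ._≟_ (F ++ G) ,
  ListAll.tabulate (λ n∈ → ListAll.lookup (ListAll.++⁺ F⊆S G⊆S) (∈-deduplicate⁻ ℕ._≟_ (F ++ G) n∈))

-- The hypotheses make `c` a bijection from pairs onto `C`. Multiplicativity is asked only up to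
-- `≈`, since floor approximations of roots multiply only in the limit.
module _ {A B C : ℕ → Set} {f g h : ℕ → ℝ} (c : ℕ → ℕ → ℕ)
  (c∈C : ∀ {m n} → A m → B n → C (c m n))
  (C⇒c : ∀ {l} → C l → ∃[ m ] ∃[ n ] A m × B n × c m n ≡ l)
  (c-injective : ∀ {m n m′ n′} → A m → B n → A m′ → B n′ → c m n ≡ c m′ n′ → m ≡ m′ × n ≡ n′)
  (0≤f : NonNegative f) (0≤g : NonNegative g)
  (h≈fg : ∀ {m n} → A m → B n → h (c m n) ≈ f m *ℝ g n)
  where

  A×B : ℕ × ℕ → Set
  A×B (m , n) = A m × B n

  factor-list : ∀ H → ListAll.All C H → ∃[ P ] ListAll.All A×B P × map (uncurry c) P ≡ H
  factor-list []      ListAll.[]        = [] , ListAll.[] , refl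
  factor-list (l ∷ H) (Cl ListAll.∷ CH) with m , n , Am , Bn , refl ← C⇒c Cl | P , AB , refl ← factor-list H CH =
    (m , n) ∷ P , (Am , Bn) ListAll.∷ AB , refl

  -- A finite H ⊇ c(F₀ × G₀) is the image of some P with F₀ × G₀ ⊆ P ⊆ F × G, so that its sum
  -- lies between (Σ F₀) (Σ G₀) and (Σ F) (Σ G).
  HasSum-* : ∀ {s t} → HasSum A f s → HasSum B g t → HasSum C h (s *ℝ t)
  HasSum-* {s} {t} fs gt ε =
    let instance ε/2>0 = half-pos ε
        δ , δ>0 , K , near-st = *-continuous s t (½ * ε)
        instance _ = δ>0
        F₀ , (F₀! , F₀⊆A) , near-s = fs δ
        G₀ , (G₀! , G₀⊆B) , near-t = gt δ
        F₀×G₀ = cartesianProduct F₀ G₀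
        H₀ = deduplicate ℕ._≟_ (map (uncurry c) F₀×G₀)
        F₀×G₀⊆ : ∀ {p} → p List.∈ F₀×G₀ → A×B p
        F₀×G₀⊆ = λ p∈ → let m∈ , n∈ = ∈-cartesianProduct⁻ F₀ G₀ p∈ in ListAll.lookup F₀⊆A m∈ , ListAll.lookup G₀⊆B n∈
        H₀⊆C : FiniteSubset C H₀
        H₀⊆C = deduplicate-! ℕ._≟_ (map (uncurry c) F₀×G₀) , ListAll.tabulate (λ l∈ →
          let p , p∈ , l≡ = ∈-map⁻ (uncurry c) (∈-deduplicate⁻ ℕ._≟_ (map (uncurry c) F₀×G₀) l∈)
          in subst C (sym l≡) (uncurry c∈C (F₀×G₀⊆ p∈)))
    in H₀ , H₀⊆C , λ H (H! , H⊆C) H₀⊆H →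
    let P , AB , P≡H = factor-list H H⊆C
        P! : Unique P
        P! = Unique.map⁻ {f = uncurry c} (subst Unique (sym P≡H) H!)
        -- Adjoining `F₀` to the first coordinates of `P` ensures that `near-s` applies to `F`.
        F = deduplicate ℕ._≟_ (F₀ ++ map proj₁ P)
        G = deduplicate ℕ._≟_ (G₀ ++ map proj₂ P)
        F⊆A = FiniteSubset-∪ F₀ (map proj₁ P) F₀⊆A (ListAll.map⁺ (ListAll.map proj₁ AB))
        G⊆B = FiniteSubset-∪ G₀ (map proj₂ P) G₀⊆B (ListAll.map⁺ (ListAll.map proj₂ AB))
        F₀⊆F = λ {n} (n∈ : n List.∈ F₀) → ∈-deduplicate⁺ ℕ._≟_ (∈-++⁺ˡ {ys = map proj₁ P} n∈)
        G₀⊆G = λ {n} (n∈ : n List.∈ G₀) → ∈-deduplicate⁺ ℕ._≟_ (∈-++⁺ˡ {ys = map proj₂ P} n∈)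
        P⊆F×G : P ⊆ cartesianProduct F G
        P⊆F×G = λ p∈ → ∈-cartesianProduct⁺
          (∈-deduplicate⁺ ℕ._≟_ (∈-++⁺ʳ F₀ (∈-map⁺ proj₁ p∈)))
          (∈-deduplicate⁺ ℕ._≟_ (∈-++⁺ʳ G₀ (∈-map⁺ proj₂ p∈)))
        F₀×G₀⊆P : F₀×G₀ ⊆ P
        F₀×G₀⊆P = λ p∈ →
          -- The inclusion of `H₀` in `H` only provides some `q` in `P` with the same image;
          -- injectivity identifies it with the given pair.
          let q , q∈ , cp≡cq = ∈-map⁻ (uncurry c) (subst (_ List.∈_) (sym P≡H)
                (H₀⊆H (∈-deduplicate⁺ ℕ._≟_ (∈-map⁺ (uncurry c) p∈))))
              Am , Bn = F₀×G₀⊆ p∈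
              Am′ , Bn′ = ListAll.lookup AB q∈
              m≡m′ , n≡n′ = c-injective Am Bn Am′ Bn′ cp≡cq
          in subst (List._∈ P) (sym (cong₂ _,_ m≡m′ n≡n′)) q∈
        F₀×G₀! = Unique.cartesianProduct⁺ F₀! G₀!
        -- `F₀` and `G₀`, as supersets of themselves, supply the lower end of the squeeze.
        M₀ , F₀≈s = near-s F₀ (F₀! , F₀⊆A) (λ n∈ → n∈)
        N₀ , G₀≈t = near-t G₀ (G₀! , G₀⊆B) (λ n∈ → n∈)
        M , F≈s = near-s F F⊆A F₀⊆F
        N , G≈t = near-t G G⊆B G₀⊆G
        L , P≈H = sum-close (λ (m , n) k → approx (h (c m n)) k) (λ (m , n) k → approx (f m) k * approx (g n) k) P
          (λ p∈ → uncurry h≈fg (ListAll.lookup AB p∈)) (½ * ε)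
        st = approx (s *ℝ t)
        ΣH = λ k → approx (Σ[ H ] h) k
        Σfg = λ k → sum (λ (m , n) → approx (f m) k * approx (g n) k)
        0≤fg : ∀ k (p : ℕ × ℕ) → 0ℚ ℚ.≤ approx (f (proj₁ p)) k * approx (g (proj₂ p)) k
        0≤fg = λ k (m , n) → 0≤p*q (0≤f m k) (0≤g n k)
        ΣΣ≡ : ∀ F G k → approx (Σ[ F ] f) k * approx (Σ[ G ] g) k ≡ Σfg k (cartesianProduct F G)
        ΣΣ≡ = λ F G k → trans (cong₂ _*_ (approx-Σ f F k) (approx-Σ g G k))
          (sym (sum-cartesianProduct (λ m → approx (f m) k) (λ n → approx (g n) k) F G))
        ΣH≡ : ∀ k → sum (λ (m , n) → approx (h (c m n)) k) P ≡ ΣH k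
        ΣH≡ = λ k → trans (sym (sum-map (λ l → approx (h l) k) (uncurry c) P))
          (trans (cong (sum (λ l → approx (h l) k)) P≡H) (sym (approx-Σ h H k)))
    in K ℕ.⊔ (M₀ ℕ.⊔ N₀ ℕ.⊔ (M ℕ.⊔ N) ℕ.⊔ L) , λ k k≥ →
    let k≥′ = ℕ.m⊔n≤o⇒n≤o K (M₀ ℕ.⊔ N₀ ℕ.⊔ (M ℕ.⊔ N) ℕ.⊔ L) k≥
        k≥K = ℕ.m⊔n≤o⇒m≤o K (M₀ ℕ.⊔ N₀ ℕ.⊔ (M ℕ.⊔ N) ℕ.⊔ L) k≥
        k≥L = ℕ.m⊔n≤o⇒n≤o (M₀ ℕ.⊔ N₀ ℕ.⊔ (M ℕ.⊔ N)) L k≥′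
        k≥″ = ℕ.m⊔n≤o⇒m≤o (M₀ ℕ.⊔ N₀ ℕ.⊔ (M ℕ.⊔ N)) L k≥′
        k≥₀ = ℕ.m⊔n≤o⇒m≤o (M₀ ℕ.⊔ N₀) (M ℕ.⊔ N) k≥″
        k≥₁ = ℕ.m⊔n≤o⇒n≤o (M₀ ℕ.⊔ N₀) (M ℕ.⊔ N) k≥″
        lower = near-st k k≥K (approx (Σ[ F₀ ] f) k) (approx (Σ[ G₀ ] g) k)
          (F₀≈s k (ℕ.m⊔n≤o⇒m≤o M₀ N₀ k≥₀)) (G₀≈t k (ℕ.m⊔n≤o⇒n≤o M₀ N₀ k≥₀))
        upper = near-st k k≥K (approx (Σ[ F ] f) k) (approx (Σ[ G ] g) k)
          (F≈s k (ℕ.m⊔n≤o⇒m≤o M N k≥₁)) (G≈t k (ℕ.m⊔n≤o⇒n≤o M N k≥₁))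
    in begin
      ∣ ΣH k - st k ∣
        ≤⟨ triangle (ΣH k) (Σfg k P) (st k) ⟩
      ∣ ΣH k - Σfg k P ∣ + ∣ Σfg k P - st k ∣
        ≤⟨ ℚ.+-mono-≤ (subst (λ z → ∣ z - Σfg k P ∣ ℚ.≤ ½ * ε) (ΣH≡ k) (P≈H k k≥L))
             (squeeze (st k)
               (ℚ.≤-trans (ℚ.≤-reflexive (ΣΣ≡ F₀ G₀ k)) (sum-mono-⊆ (0≤fg k) F₀×G₀! F₀×G₀⊆P))
               (ℚ.≤-trans (sum-mono-⊆ (0≤fg k) P! P⊆F×G) (ℚ.≤-reflexive (sym (ΣΣ≡ F G k))))
               lower upper) ⟩
      ½ * ε + ½ * ε
        ≡⟨ split ε ⟩
      ε ∎
    where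
    open ℚ.≤-Reasoning

-- The sum over 𝒫σ

-- Carries sums found for an abstract family of roots over to the concrete one.
HasSum-resp : ∀ {S f g s} → (∀ n k → approx (f n) k ≡ approx (g n) k) → HasSum S f s → HasSum S g s
HasSum-resp {f = f} {g} {s} f≡g h ε =
  let F₀ , F₀⊆S , near = h ε
  in F₀ , F₀⊆S , λ F F⊆S F₀⊆F → let N , close = near F F⊆S F₀⊆F in N , λ k k≥ →
    subst (λ t → ∣ t - approx s k ∣ ℚ.≤ ε)
      (trans (approx-Σ f F k) (trans (sum-cong (λ n → f≡g n k) F) (sym (approx-Σ g F k))))
      (close k k≥)

-- Approximate multiplicativity of roots

floor-≤ : ∀ K n a b → ⌊ K * n ^-[ a / b ]⌋ ℕ.≤ K
floor-≤ K n a b = largest-≤ (λ m → m ℕ.^ b ℕ.* n ℕ.^ a ℕ.≤? K ℕ.^ b) K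

-- Below `K` this is maximality of the floor; at `K` it holds because n^a ≥ 1.
floor-maximal : ∀ K n a b .{{_ : NonZero n}} → K ℕ.^ b ℕ.≤ suc ⌊ K * n ^-[ a / b ]⌋ ℕ.^ b ℕ.* n ℕ.^ a
floor-maximal K n a b with ⌊ K * n ^-[ a / b ]⌋ ℕ.<? K
... | yes u<K = ℕ.<⇒≤ (ℕ.≰⇒> λ fits → ℕ.<⇒≱ ℕ.≤-refl
      (largest-maximal (λ m → m ℕ.^ b ℕ.* n ℕ.^ a ℕ.≤? K ℕ.^ b) K u<K fits))
... | no  u≮K = ℕ.≤-trans (ℕ.^-monoˡ-≤ b (ℕ.m≤n⇒m≤1+n (ℕ.≮⇒≥ u≮K)))
      (ℕ.m≤m*n _ (n ℕ.^ a) {{ℕ.m^n≢0 n a}})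

^-*-cancelʳ-≤ : ∀ b e .{{_ : NonZero b}} .{{_ : NonZero e}} {x y} → x ℕ.^ b ℕ.* e ℕ.≤ y ℕ.^ b ℕ.* e → x ℕ.≤ y
^-*-cancelʳ-≤ b e le = ^-cancelʳ-≤ b (ℕ.*-cancelʳ-≤ _ _ e le)

module _ (m n a b : ℕ) .{{_ : NonZero m}} .{{_ : NonZero n}} .{{_ : NonZero b}} where

  private
    c = m ℕ.^ a
    instance
      c≢0 = ℕ.m^n≢0 m a
      cn≢0 = ℕ.m*n≢0 (m ℕ.^ a) n

    ^-*-interchange : ∀ x y → (x ℕ.* y) ℕ.^ b ℕ.* (c ℕ.* n) ≡ (x ℕ.^ b ℕ.* c) ℕ.* (y ℕ.^ b ℕ.* n)
    ^-*-interchange x y = trans (cong (ℕ._* (c ℕ.* n)) (^-distribʳ-* x y b))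
      (ℕ.[m*n]*[o*p]≡[m*o]*[n*p] (x ℕ.^ b) (y ℕ.^ b) c n)

  module _ (K : ℕ) where

    private
      u = ⌊ K * m ^-[ a / b ]⌋
      v = ⌊ K * n ^-[ 1 / b ]⌋
      w = ⌊ K * c ℕ.* n ^-[ 1 / b ]⌋

      v≤ : v ℕ.^ b ℕ.* n ℕ.≤ K ℕ.^ b
      v≤ = subst (λ d → v ℕ.^ b ℕ.* d ℕ.≤ K ℕ.^ b) (ℕ.*-identityʳ n) (floor-spec K n 1 b)
      v> : K ℕ.^ b ℕ.≤ suc v ℕ.^ b ℕ.* n
      v> = subst (λ d → K ℕ.^ b ℕ.≤ suc v ℕ.^ b ℕ.* d) (ℕ.*-identityʳ n) (floor-maximal K n 1 b)
      w≤ : w ℕ.^ b ℕ.* (c ℕ.* n) ℕ.≤ K ℕ.^ b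
      w≤ = subst (λ d → w ℕ.^ b ℕ.* d ℕ.≤ K ℕ.^ b) (ℕ.*-identityʳ (c ℕ.* n)) (floor-spec K (c ℕ.* n) 1 b)
      w> : K ℕ.^ b ℕ.≤ suc w ℕ.^ b ℕ.* (c ℕ.* n)
      w> = subst (λ d → K ℕ.^ b ℕ.≤ suc w ℕ.^ b ℕ.* d) (ℕ.*-identityʳ (c ℕ.* n)) (floor-maximal K (c ℕ.* n) 1 b)

    -- In the reals, u v ≤ K · K (m^a n)^(-1/b) ≤ K (w + 1). Taking `b`-th powers and multiplying by
    -- `c ℕ.* n` keeps the argument in ℕ; the lower bound is symmetric.
    floor-*-upper : u ℕ.* v ℕ.≤ K ℕ.* suc w
    floor-*-upper = ^-*-cancelʳ-≤ b (c ℕ.* n) (begin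
      (u ℕ.* v) ℕ.^ b ℕ.* (c ℕ.* n)                ≡⟨ ^-*-interchange u v ⟩
      (u ℕ.^ b ℕ.* c) ℕ.* (v ℕ.^ b ℕ.* n)          ≤⟨ ℕ.*-mono-≤ (floor-spec K m a b) v≤ ⟩
      K ℕ.^ b ℕ.* K ℕ.^ b                          ≤⟨ ℕ.*-monoʳ-≤ (K ℕ.^ b) w> ⟩
      K ℕ.^ b ℕ.* (suc w ℕ.^ b ℕ.* (c ℕ.* n))      ≡⟨ ℕ.*-assoc (K ℕ.^ b) (suc w ℕ.^ b) (c ℕ.* n) ⟨
      K ℕ.^ b ℕ.* suc w ℕ.^ b ℕ.* (c ℕ.* n)        ≡⟨ cong (ℕ._* (c ℕ.* n)) (^-distribʳ-* K (suc w) b) ⟨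
      (K ℕ.* suc w) ℕ.^ b ℕ.* (c ℕ.* n)            ∎)
      where open ℕ.≤-Reasoning

    floor-*-lower : K ℕ.* w ℕ.≤ suc u ℕ.* suc v
    floor-*-lower = ^-*-cancelʳ-≤ b (c ℕ.* n) (begin
      (K ℕ.* w) ℕ.^ b ℕ.* (c ℕ.* n)                ≡⟨ cong (ℕ._* (c ℕ.* n)) (^-distribʳ-* K w b) ⟩
      K ℕ.^ b ℕ.* w ℕ.^ b ℕ.* (c ℕ.* n)            ≡⟨ ℕ.*-assoc (K ℕ.^ b) (w ℕ.^ b) (c ℕ.* n) ⟩
      K ℕ.^ b ℕ.* (w ℕ.^ b ℕ.* (c ℕ.* n))          ≤⟨ ℕ.*-monoʳ-≤ (K ℕ.^ b) w≤ ⟩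
      K ℕ.^ b ℕ.* K ℕ.^ b                          ≤⟨ ℕ.*-mono-≤ (floor-maximal K m a b) v> ⟩
      (suc u ℕ.^ b ℕ.* c) ℕ.* (suc v ℕ.^ b ℕ.* n)  ≡⟨ ^-*-interchange (suc u) (suc v) ⟨
      (suc u ℕ.* suc v) ℕ.^ b ℕ.* (c ℕ.* n)        ∎)
      where open ℕ.≤-Reasoning

  rootApprox-* : ∀ k → ∣ rootApprox 1 b (m ℕ.^ a ℕ.* n) k - rootApprox a b m k * rootApprox 1 b n k ∣ ℚ.≤ + 3 / suc k
  rootApprox-* k = subst (λ t → ∣ + w / K - t ∣ ℚ.≤ + 3 / K) (sym (/-*-/ u K v K)) (∣-∣≤ lower upper)
    where
    open ℚ.≤-Reasoning
    K = suc k
    u = ⌊ K * m ^-[ a / b ]⌋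
    v = ⌊ K * n ^-[ 1 / b ]⌋
    w = ⌊ K * c ℕ.* n ^-[ 1 / b ]⌋
    u≤K : u ℕ.≤ K
    u≤K = floor-≤ K m a b
    v≤K : v ℕ.≤ K
    v≤K = floor-≤ K n 1 b
    instance KK≢0 = ℕ.m*n≢0 K K
    lower : + w / K ℚ.≤ + (u ℕ.* v) / (K ℕ.* K) + + 3 / K
    lower = begin
      + w / K
        ≤⟨ /-mono-≤ w K (u ℕ.* v ℕ.+ 3 ℕ.* K) (K ℕ.* K) (ℕ.≤-trans
             (ℕ.≤-reflexive (solve 2 (λ w K → w :* (K :* K) := K :* w :* K) refl w K))
             (ℕ.*-monoˡ-≤ K wK≤)) ⟩
      + (u ℕ.* v ℕ.+ 3 ℕ.* K) / (K ℕ.* K)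
        ≡⟨ /-distrib-+ (u ℕ.* v) (3 ℕ.* K) (K ℕ.* K) ⟩
      + (u ℕ.* v) / (K ℕ.* K) + + (3 ℕ.* K) / (K ℕ.* K)
        ≤⟨ ℚ.+-monoʳ-≤ (+ (u ℕ.* v) / (K ℕ.* K)) (/-mono-≤ (3 ℕ.* K) (K ℕ.* K) 3 K
             (ℕ.≤-reflexive (ℕ.*-assoc 3 K K))) ⟩
      + (u ℕ.* v) / (K ℕ.* K) + + 3 / K ∎
      where
      open +-*-Solver
      -- The constant 3 arises from (u+1)(v+1) = uv + u + v + 1, where `u`, `v` and 1 are each at
      -- most `K`.
      wK≤ : K ℕ.* w ℕ.≤ u ℕ.* v ℕ.+ 3 ℕ.* K
      wK≤ = ℕ.≤-trans (floor-*-lower K) (ℕ.≤-trans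
        (ℕ.≤-reflexive (solve 2 (λ u v → (con 1 :+ u) :* (con 1 :+ v) := u :* v :+ (u :+ (v :+ con 1))) refl u v))
        (ℕ.+-monoʳ-≤ (u ℕ.* v) (ℕ.≤-trans (ℕ.+-mono-≤ u≤K (ℕ.+-mono-≤ v≤K (ℕ.s≤s ℕ.z≤n)))
          (ℕ.≤-reflexive (solve 1 (λ K → K :+ (K :+ K) := con 3 :* K) refl K)))))
    upper : + (u ℕ.* v) / (K ℕ.* K) ℚ.≤ + w / K + + 3 / K
    upper = begin
      + (u ℕ.* v) / (K ℕ.* K)
        ≤⟨ /-mono-≤ (u ℕ.* v) (K ℕ.* K) (w ℕ.+ 3) K (ℕ.≤-trans
             (ℕ.*-monoˡ-≤ K (ℕ.≤-trans (floor-*-upper K) (ℕ.*-monoʳ-≤ K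
               (ℕ.≤-trans (ℕ.≤-reflexive (ℕ.+-comm 1 w)) (ℕ.+-monoʳ-≤ w (ℕ.s≤s (ℕ.z≤n {2})))))))
             (ℕ.≤-reflexive (solve 2 (λ w K → K :* w :* K := w :* (K :* K)) refl (w ℕ.+ 3) K))) ⟩
      + (w ℕ.+ 3) / K
        ≡⟨ /-distrib-+ w 3 K ⟩
      + w / K + + 3 / K ∎
      where open +-*-Solver

  isRoot-* : ∀ {f g} → IsRoot a b f → IsRoot 1 b g → g (m ℕ.^ a ℕ.* n) ≈ f m *ℝ g n
  isRoot-* {f} {g} f-root g-root ε = 3 ℕ.* ℚ.↧ₙ ε , λ k k≥ →
    subst (ℚ._≤ ε) (cong ∣_∣ (sym (cong₂ _-_ (g-root (m ℕ.^ a ℕ.* n) k) (cong₂ _*_ (f-root m k) (g-root n k)))))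
      (ℚ.≤-trans (rootApprox-* k) (ℚ.≤-trans
        (/-mono-≤ 3 (suc k) 1 (ℚ.↧ₙ ε) (ℕ.≤-trans (ℕ.m≤n⇒m≤1+n k≥) (ℕ.≤-reflexive (sym (ℕ.*-identityˡ (suc k))))))
        (1/denominator≤ ε)))

rootApprox-1 : ∀ b k → rootApprox 1 b 1 k ≡ 1ℚ
rootApprox-1 b k = ℚ.≤-antisym
  (/-mono-≤ u K 1 1 (subst₂ ℕ._≤_ (sym (ℕ.*-identityʳ u)) (sym (ℕ.*-identityˡ K)) (floor-≤ K 1 1 b)))
  (/-mono-≤ 1 1 u K (subst₂ ℕ._≤_ (sym (ℕ.*-identityˡ K)) (sym (ℕ.*-identityʳ u))
    (largest-maximal (λ m → m ℕ.^ b ℕ.* 1 ℕ.≤? K ℕ.^ b) K ℕ.≤-refl (ℕ.≤-reflexive (ℕ.*-identityʳ (K ℕ.^ b))))))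
  where
  K = suc k
  u = ⌊ K * 1 ^-[ 1 / b ]⌋

-- Induction on the exponent vector

value-nonZero : ∀ {r} (β ps : Vec ℕ r) → All Prime ps → NonZero (value β ps)
value-nonZero []      []       []         = _
value-nonZero (a ∷ β) (p ∷ ps) (pp ∷ psp) =
  ℕ.m*n≢0 (p ℕ.^ a) (value β ps) {{ℕ.m^n≢0 p a {{prime⇒nonZero pp}}}} {{value-nonZero β ps psp}}

singleton-unique : ∀ {x : A} {xs} → Unique xs → ListAll.All (_≡ x) xs → x List.∈ xs → xs ≡ x ∷ []
singleton-unique {xs = y ∷ []}     _ (refl ListAll.∷ _) _ = refl
singleton-unique {xs = y ∷ z ∷ xs} ((y≢z ListAll.∷ _) ∷ _) (refl ListAll.∷ z≡ ListAll.∷ _) _ = contradiction (sym z≡) y≢z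

-- The empty product 1 is the only element, and every approximation of its root is exactly 1, so the
-- threshold can be 0.
HasSum-𝒫σ-[] : ∀ b {f} → IsRoot 1 b f → HasSum (𝒫σ []) f 1ℝ
HasSum-𝒫σ-[] b {f} isRoot ε =
  1 ∷ [] , (ListAll.[] ∷ [] , ([] , [] , refl) ListAll.∷ ListAll.[]) , λ F (F! , F⊆) 1⊆F →
  let F≡ = singleton-unique F! (ListAll.map (λ { ([] , _ , n≡1) → n≡1 }) F⊆) (1⊆F (here refl))
  in 0 , λ k _ → subst (λ t → ∣ t - 1ℚ ∣ ℚ.≤ ε)
       (sym (trans (cong (λ F → approx (Σ[ F ] f) k) F≡)
         (trans (ℚ.+-identityʳ (approx (f 1) k)) (trans (isRoot 1 k) (rootApprox-1 b k)))))
       (ℚ.<⇒≤ (ℚ.positive⁻¹ ε))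

-- A relation for the tail extends by the coefficient 0.
signedSumFree-tail : ∀ {r a} {β : Vec ℕ r} → SignedSumFree (a ∷ β) → SignedSumFree β
signedSumFree-tail {a = a} free ε ε∈ sum≡0
  with _ ∷ ε≡0 ← free (0ℤ ∷ ε) (there (here refl) ∷ ε∈)
    (trans (cong₂ ℤ._+_ (ℤ.*-zeroˡ (+ a)) sum≡0) (ℤ.+-identityʳ 0ℤ)) = ε≡0

HasSum-𝒫σ : ∀ {r} b .{{_ : NonZero b}} (f : ℕ → ℕ → ℝ) → (∀ a → IsRoot a b (f a)) →
  (β : Vec ℕ r) → All (b ℕ.<_) β → SignedSumFree β →
  Σ[ Ps ∈ Vec ℝ r ] Pointwise (λ a P → HasSum Prime (f a) P) β Ps × HasSum (𝒫σ β) (f 1) (∏ Ps)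
HasSum-𝒫σ b f isRoot []      []          free = [] , [] , HasSum-𝒫σ-[] b {f 1} (isRoot 1)
HasSum-𝒫σ b f isRoot (a ∷ β) (b<a ∷ b<β) free =
  let P , prime-sum = primeSum a b {f a} b<a (isRoot a)
      Ps , prime-sums , β-sum = HasSum-𝒫σ b f isRoot β b<β (signedSumFree-tail {β = β} free)
  in P ∷ Ps , prime-sum ∷ prime-sums ,
     -- Since (p^a n)^(-1/b) = p^(-a/b) n^(-1/b), the leading exponent passes into the root `f a` of
     -- the prime, while `f 1` serves both sets of products.
     HasSum-* {Prime} {𝒫σ β} {𝒫σ (a ∷ β)} {f a} {f 1} {f 1} (λ p n → p ℕ.^ a ℕ.* n)
       (λ {p} pp (ps , psp , n≡) → p ∷ ps , pp ∷ psp , cong (p ℕ.^ a ℕ.*_) n≡)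
       (λ { (p ∷ ps , pp ∷ psp , l≡) → p , value β ps , pp , (ps , psp , refl) , sym l≡ })
       -- This is where (*) enters: equal products have equal tuples, hence equal leading primes and
       -- equal remaining products.
       (λ {p} {_} {q} pp (ps , psp , m≡) qp (qs , qsp , n≡) eq →
         let p≡q , ps≡qs = ∷-injective (value-injective {β = a ∷ β} {p ∷ ps} {q ∷ qs} free (pp ∷ psp) (qp ∷ qsp)
               (trans (cong (p ℕ.^ a ℕ.*_) (sym m≡)) (trans eq (cong (q ℕ.^ a ℕ.*_) n≡))))
         in p≡q , trans m≡ (trans (cong (value β) ps≡qs) (sym n≡)))
       (isRoot-nonNeg a b {f a} (isRoot a)) (isRoot-nonNeg 1 b {f 1} (isRoot 1))
       (λ {p} {n} pp (ps , psp , n≡) → isRoot-* p n a b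
         {{prime⇒nonZero pp}} {{subst NonZero (sym n≡) (value-nonZero β ps psp)}} {f = f a} {f 1} (isRoot a) (isRoot 1))
       {P} {∏ Ps} prime-sum β-sum

theorem2 : ∀ {r} (α : ℕ) .{{_ : NonZero α}} (β : Vec ℕ (suc r)) →
    α < head β → Linked _≤_ β →
    (SignedSumFree β →
    Σ[ Ps ∈ Vec ℝ (suc r) ]
    Pointwise (λ αᵢ P → PrimeZeta[ αᵢ / α ]≈ P) β Ps ×
    HasSum (𝒫σ β) (λ n → n ^-[ 1 / α ]) (∏ Ps))
    × (SignedSumFree β ⇔ UniqueRepresentations β)
theorem2 α ⦃ z ⦄ β α<β β-sorted =
  (λ free →
    let Ps , prime-sums , β-sum = HasSum-𝒫σ α ⦃ z ⦄ root (λ _ _ _ → refl) β α<all free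
    in Ps ,
       Pointwise.map (λ {a} {P} → HasSum-resp {Prime} {root a} {λ n → _^-[_/_] n a α ⦃ z ⦄} {P} (λ _ _ → refl)) prime-sums ,
       HasSum-resp {𝒫σ β} {root 1} {λ n → _^-[_/_] n 1 α ⦃ z ⦄} {∏ Ps} (λ _ _ → refl) β-sum) ,
  mk⇔ (signedSumFree⇒unique β) (unique⇒signedSumFree β)
  where
  root : ℕ → ℕ → ℝ
  root a n = _^-[_/_] n a α ⦃ z ⦄
  -- Sortedness carries the strict bound from the first exponent to all of them, so each prime sum
  -- converges.
  α<all : All (α <_) β
  α<all = All.map (ℕ.<-≤-trans α<β) (Linked⇒All ℕ.≤-trans ℕ.≤-refl β-sorted)
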